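{- For $f\in\mathcal L_{5,3}^+$ with normalized coefficients $c_\alpha$ ($\alpha\in\Delta_5^3$; e.g. $c_{21000}$ means $c_{(2,1,0,0,0)}$), let $$R_5(f)=\frac{c_{30000}\,c_{21000}\,c_{10101}\,c_{00210}\,c_{00021}}{c_{20100}\,c_{20010}\,c_{20001}\,c_{01110}\,c_{00111}},$$ and let $w_5\in\mathbb R^{\Delta_5^3}$ be its exponent vector (entry $+1$ at the five numerator indices, $-1$ at the five denominator indices, $0$ elsewhere). Then for every $f\in\mathcal L_{5,3}^+$, $R_5(f)\le 32$. Moreover, $$w_5\in\operatorname{BR}(\mathcal L_{5,3}^+)\setminus\operatorname{Cone}\bigl(\mathcal G_5(\Delta_5^3)\bigr).$$ In particular, $\operatorname{Cone}(\mathcal G_5(\Delta_5^3))\subsetneq\operatorname{BR}(\mathcal L_{5,3}^+)$.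
   Context: Notation: $\mathbb N=\mathbb Z_{\ge0}$, $[n]=\{1,\dots,n\}$, $e_i$ is the $i$-th standard basis vector of $\mathbb R^n$; for $\alpha\in\mathbb N^n$, $|\alpha|=\alpha_1+\cdots+\alpha_n$, $\alpha!=\alpha_1!\cdots\alpha_n!$, and $\mathbf x^\alpha=x_1^{\alpha_1}\cdots x_n^{\alpha_n}$; $\Delta_n^d=\{\alpha\in\mathbb N^n:|\alpha|=d\}$. For a finite set $S$, $\varepsilon_\alpha$ ($\alpha\in S$) denotes the standard basis of $\mathbb R^S$. $\operatorname{Cone}(E)$ is the set of finite nonnegative linear combinations of elements of $E$. A nonempty set $S\subseteq\Delta_n^d$ is $M$-convex if, whenever $\alpha,\beta\in S$ and $\alpha_i>\beta_i$, there is $j$ with $\alpha_j<\beta_j$ such that $\alpha-e_i+e_j\in S$ and $\beta-e_j+e_i\in S$. Lorentzian polynomials: for $d\ge2$, a polynomial $f=\sum_{\alpha\in\Delta_n^d}c_\alpha\,\mathbf x^\alpha/\alpha!$ with all $c_\alpha\ge0$, not identically zero, is Lorentzian if and only if its support $\{\alpha:c_\alpha\ne0\}$ is $M$-convex and for every $\beta\in\Delta_n^{d-2}$ the symmetric matrix $H_\beta(f)=(c_{\beta+e_i+e_j})_{1\le i,j\le n}$ (the Hessian of $\partial^\beta f$) has at most one positive eigenvalue. The numbers $c_\alpha$ are called the normalized coefficients of $f$. For an $M$-convex $S\subseteq\Delta_n^d$, $\mathcal L_S^+$ is the set of Lorentzian polynomials whose normalized coefficients $c_\alpha$ are positive exactly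 for $\alpha\in S$; $\mathcal L_{n,d}^+:=\mathcal L_{\Delta_n^d}^+$. For $w\in\mathbb R^S$ and $f\in\mathcal L_S^+$ put $R_w(f)=\prod_{\alpha\in S}c_\alpha^{w_\alpha}$, and $\operatorname{BR}(\mathcal L_S^+)=\{w\in\mathbb R^S:\sup_{f\in\mathcal L_S^+}R_w(f)<\infty\}$. Quadratic local generators: for $\beta\in\Delta_n^{d-2}$ let $S_\beta=\{e_i+e_j:i,j\in[n],\ \beta+e_i+e_j\in S\}\subseteq\Delta_n^2$ (which is $M$-convex whenever nonempty; for $S=\Delta_n^d$ it is $\Delta_n^2$). For $v\in\mathbb R^{S_\beta}$ let $\widetilde v^{\,\beta}=\sum_{\gamma\in S_\beta}v_\gamma\varepsilon_{\beta+\gamma}\in\mathbb R^S$. Then $\mathcal G_n(S)=\bigcup_{\beta\in\Delta_n^{d-2},\,S_\beta\ne\varnothing}\{\widetilde v^{\,\beta}:v\in\operatorname{BR}(\mathcal L_{S_\beta}^+)\}$. -}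

module Defs where

open import Algebra.Bundles using (CommutativeRing)
open import Algebra.Definitions.RawMonoid using () renaming (sum to foldSum; _×_ to multiple)
open import Data.Bool.Base using (Bool; true; T; if_then_else_)
open import Data.Bool.Properties using (T?)
open import Data.Fin.Base using (Fin; zero; suc)
open import Data.Irrelevant using ([_])
open import Data.List.Base as List using (List; []; _∷_; _++_; mapMaybe)
open import Data.List.Membership.Propositional using () renaming (_∈_ to _∈ₗ_)
open import Data.List.Membership.Propositional.Properties using (∈-map⁺; ∈-map⁻; ∈-++⁺ˡ; ∈-++⁺ʳ)
open import Data.List.Relation.Unary.All using ([])
open import Data.List.Relation.Unary.Any using (here; there)
open import Data.List.Relation.Unary.Unique.Propositional using (Unique; []; _∷_)
open import Data.List.Relation.Unary.Unique.Propositional.Properties using (map⁺; ++⁺)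
open import Data.Maybe.Base using (Maybe; just; nothing)
open import Data.Nat.Base as ℕ using (ℕ; zero; suc)
import Data.Nat.Properties as ℕₚ
open import Data.Product.Base using (Σ-syntax; ∃; ∃-syntax; ∃₂; _×_; _,_; proj₁; proj₂)
open import Data.Refinement.Base using (Refinement; value) renaming (_,_ to _⊣_)
open import Data.Vec.Base as Vec using (Vec; []; _∷_; lookup; zipWith; replicate)
import Data.Vec.Properties as Vecₚ
open import Function.Bundles using (_⇔_)
open import Level using (Level; _⊔_) renaming (suc to lsuc)
open import Relation.Binary.Core using (Rel)
import Relation.Binary.Construct.StrictToNonStrict as StrictToNonStrict
open import Relation.Binary.PropositionalEquality using (_≡_; refl; cong; cong₂; sym; trans)
open import Relation.Binary.Structures using (IsStrictTotalOrder)
open import Relation.Nullary using (¬_; Dec; yes; no)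
open import Relation.Nullary.Decidable using (⌊_⌋; map′; recompute)
open import Relation.Unary using (Pred; Satisfiable; _∈_)

-- The real numbers, characterised (uniquely up to isomorphism) as a totally
-- ordered field in which every inhabited set bounded above has a least upper
-- bound.
record RealNumbers (c ℓ : Level) : Set (lsuc (c ⊔ ℓ)) where
  infix  4 _<_
  infix  8 _⁻¹
  field
    commutativeRing : CommutativeRing c ℓ

  open CommutativeRing commutativeRing public

  field
    _<_                : Rel Carrier ℓ
    isStrictTotalOrder : IsStrictTotalOrder _≈_ _<_
    0<1                : 0# < 1#
    +-monoˡ-<          : ∀ z {x y} → x < y → x + z < y + z
    *-pos              : ∀ {x y} → 0# < x → 0# < y → 0# < x * y

    -- The value at 0# is unspecified, and so is that of log outside (0,∞).
    _⁻¹      : Carrier → Carrier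
    *-inverseʳ : ∀ x → ¬ (x ≈ 0#) → x * x ⁻¹ ≈ 1#

  open StrictToNonStrict _≈_ _<_ public using (_≤_)

  UpperBound : Pred Carrier (c ⊔ ℓ) → Pred Carrier (c ⊔ ℓ)
  UpperBound P b = ∀ {x} → P x → x ≤ b

  field
    sup : (P : Pred Carrier (c ⊔ ℓ)) → Satisfiable P → Satisfiable (UpperBound P) →
          ∃[ s ] (s ∈ UpperBound P × (∀ {b} → b ∈ UpperBound P → s ≤ b))

    -- An order isomorphism from (ℝ, +) to ((0,∞), *), that is, exponential and
    -- logarithm to some base greater than 1.  Every complete ordered field has
    -- one, and the power defined below does not depend on its choice.
    exp       : Carrier → Carrier
    log       : Carrier → Carrier
    exp-cong  : ∀ {x y} → x ≈ y → exp x ≈ exp y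
    exp-+     : ∀ x y → exp (x + y) ≈ exp x * exp y
    exp-pos   : ∀ x → 0# < exp x
    exp-mono-< : ∀ {x y} → x < y → exp x < exp y
    exp-log   : ∀ {x} → 0# < x → exp (log x) ≈ x

  infixl 7 _÷_
  _÷_ : Carrier → Carrier → Carrier
  x ÷ y = x * y ⁻¹

  -- Real powers of positive reals.
  infixr 8 _^_
  _^_ : Carrier → Carrier → Carrier
  x ^ a = exp (a * log x)

  fromℕ : ℕ → Carrier
  fromℕ m = multiple +-rawMonoid m 1#

  ∑ : ∀ {n} → (Fin n → Carrier) → Carrier
  ∑ = foldSum +-rawMonoid

  ∑[_] : ∀ {a} {A : Set a} → List A → (A → Carrier) → Carrier
  ∑[ xs ] f = List.foldr _+_ 0# (List.map f xs)

  ∏[_] : ∀ {a} {A : Set a} → List A → (A → Carrier) → Carrier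
  ∏[ xs ] f = List.foldr _*_ 1# (List.map f xs)

------------------------------------------------------------------------
-- Multi-indices of fixed degree

-- The proof component is irrelevant, so multi-indices with equal exponent
-- vectors are equal.
Δ : ℕ → ℕ → Set
Δ n d = Refinement (Vec ℕ n) (λ α → Vec.sum α ≡ d)

⟦_⟧ : ∀ {n} (α : Vec ℕ n) → Δ n (Vec.sum α)
⟦ α ⟧ = α ⊣ [ refl ]

infix 9 _at_
_at_ : ∀ {n d} → Δ n d → Fin n → ℕ
α at i = lookup (value α) i

_≟Δ_ : ∀ {n d} (α β : Δ n d) → Dec (α ≡ β)
(α ⊣ [ _ ]) ≟Δ (β ⊣ [ _ ]) =
  map′ (λ { refl → refl }) (cong value) (Vecₚ.≡-dec ℕₚ._≟_ α β)

sum-zipWith-+ : ∀ {n} (u v : Vec ℕ n) →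
                Vec.sum (zipWith ℕ._+_ u v) ≡ Vec.sum u ℕ.+ Vec.sum v
sum-zipWith-+ []      []      = refl
sum-zipWith-+ (x ∷ u) (y ∷ v) =
  trans (cong (x ℕ.+ y ℕ.+_) (sum-zipWith-+ u v))
        (+-interchange x y (Vec.sum u) (Vec.sum v))
  where
  open import Algebra.Properties.CommutativeSemigroup ℕₚ.+-commutativeSemigroup
    using () renaming (interchange to +-interchange)

infixr 6 _⊕_
_⊕_ : ∀ {n d d′} → Δ n d → Δ n d′ → Δ n (d ℕ.+ d′)
(α ⊣ [ p ]) ⊕ (β ⊣ [ q ]) =
  zipWith ℕ._+_ α β ⊣ [ trans (sum-zipWith-+ α β) (cong₂ ℕ._+_ p q) ]

sum-replicate-0 : ∀ n → Vec.sum (replicate n 0) ≡ 0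
sum-replicate-0 zero    = refl
sum-replicate-0 (suc n) = sum-replicate-0 n

unit : ∀ {n} → Fin n → Vec ℕ n
unit zero    = 1 ∷ replicate _ 0
unit (suc i) = 0 ∷ unit i

sum-unit : ∀ {n} (i : Fin n) → Vec.sum (unit i) ≡ 1
sum-unit {suc n} zero = cong suc (sum-replicate-0 n)
sum-unit (suc i)      = sum-unit i

e : ∀ {n} → Fin n → Δ n 1
e i = unit i ⊣ [ sum-unit i ]

bump : ∀ {n d} → Δ (suc n) d → Δ (suc n) (suc d)
bump ((k ∷ α) ⊣ [ p ]) = (suc k ∷ α) ⊣ [ cong suc p ]

0∷_ : ∀ {n d} → Δ n d → Δ (suc n) d
0∷ (α ⊣ [ p ]) = (0 ∷ α) ⊣ [ p ]

allΔ : ∀ n d → List (Δ n d)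
allΔ zero    zero    = ⟦ [] ⟧ ∷ []
allΔ zero    (suc d) = []
allΔ (suc n) zero    = List.map 0∷_ (allΔ n zero)
allΔ (suc n) (suc d) = List.map bump (allΔ (suc n) d) ++ List.map 0∷_ (allΔ n (suc d))

allΔ-complete : ∀ {n d} (α : Δ n d) → α ∈ₗ allΔ n d
allΔ-complete {zero}  {zero}  ([] ⊣ [ p ])           = here refl
allΔ-complete {zero}  {suc d} ([] ⊣ [ () ])
allΔ-complete {suc n} {zero}  ((zero ∷ α) ⊣ [ p ])   =
  ∈-map⁺ 0∷_ (allΔ-complete (α ⊣ [ p ]))
allΔ-complete {suc n} {zero}  ((suc k ∷ α) ⊣ [ () ])
allΔ-complete {suc n} {suc d} ((zero ∷ α) ⊣ [ p ])   =
  ∈-++⁺ʳ (List.map bump (allΔ (suc n) d)) (∈-map⁺ 0∷_ (allΔ-complete (α ⊣ [ p ])))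
allΔ-complete {suc n} {suc d} ((suc k ∷ α) ⊣ [ p ])  =
  ∈-++⁺ˡ (∈-map⁺ bump (allΔ-complete ((k ∷ α) ⊣ [ ℕₚ.suc-injective p ])))

0∷-injective : ∀ {n d} {α β : Δ n d} → 0∷ α ≡ 0∷ β → α ≡ β
0∷-injective refl = refl

bump-injective : ∀ {n d} {α β : Δ (suc n) d} → bump α ≡ bump β → α ≡ β
bump-injective {α = (_ ∷ _) ⊣ _} {(_ ∷ _) ⊣ _} refl = refl

bump≢0∷ : ∀ {n d} (α : Δ (suc n) d) β → ¬ (bump α ≡ 0∷ β)
bump≢0∷ ((_ ∷ _) ⊣ _) β ()

allΔ-unique : ∀ n d → Unique (allΔ n d)
allΔ-unique zero    zero    = [] ∷ []
allΔ-unique zero    (suc d) = []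
allΔ-unique (suc n) zero    = map⁺ 0∷-injective (allΔ-unique n zero)
allΔ-unique (suc n) (suc d) =
  ++⁺ (map⁺ bump-injective (allΔ-unique (suc n) d))
      (map⁺ 0∷-injective (allΔ-unique n (suc d))) disjoint
  where
  disjoint : ∀ {γ} → ¬ (γ ∈ₗ List.map bump (allΔ (suc n) d) ×
                         γ ∈ₗ List.map 0∷_ (allΔ n (suc d)))
  disjoint (p , q) with ∈-map⁻ bump p | ∈-map⁻ 0∷_ q
  ... | α , _ , γ≡bump | β , _ , γ≡0∷ = bump≢0∷ α β (trans (sym γ≡bump) γ≡0∷)

Subset : ℕ → ℕ → Set
Subset n d = Δ n d → Bool

full : ∀ {n d} → Subset n d
full _ = true

Elem : ∀ {n d} → Subset n d → Set
Elem {n} {d} S = Refinement (Δ n d) (λ α → T (S α))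

elements : ∀ {n d} (S : Subset n d) → List (Elem S)
elements S = mapMaybe toElem (allΔ _ _)
  where
  toElem : ∀ α → Maybe (Elem S)
  toElem α with T? (S α)
  ... | yes p = just (α ⊣ [ p ])
  ... | no  _ = nothing

-- S_β; every element of Δ n 2 has the form e i ⊕ e j (Δ²-split below).
link : ∀ {n k} → Subset n (2 ℕ.+ k) → Δ n k → Subset n 2
link S β γ = S (γ ⊕ β)

Δ²-split : ∀ {n} (γ : Δ n 2) → ∃₂ λ i j → γ ≡ e i ⊕ e j
Δ²-split (v ⊣ [ p ]) =
  let i , j , eq = split₂ v (recompute (Vec.sum v ℕₚ.≟ 2) p) in i , j , toΔ eq
  where
  split₀ : ∀ {n} (w : Vec ℕ n) → Vec.sum w ≡ 0 → w ≡ replicate n 0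
  split₀ []         _ = refl
  split₀ (zero ∷ w) q = cong (0 ∷_) (split₀ w q)
  split₁ : ∀ {n} (w : Vec ℕ n) → Vec.sum w ≡ 1 → ∃ λ i → w ≡ unit i
  split₁ (zero ∷ w) q with split₁ w q
  ... | i , eq = suc i , cong (0 ∷_) eq
  split₁ (suc zero ∷ w) q = zero , cong (1 ∷_) (split₀ w (cong ℕ.pred q))
  zero-+ : ∀ {n} (w : Vec ℕ n) → zipWith ℕ._+_ (replicate n 0) w ≡ w
  zero-+ = Vecₚ.zipWith-identityˡ (λ _ → refl)
  split₂ : ∀ {n} (w : Vec ℕ n) → Vec.sum w ≡ 2 →
           ∃₂ λ i j → w ≡ zipWith ℕ._+_ (unit i) (unit j)
  split₂ (zero ∷ w) q with split₂ w q
  ... | i , j , eq = suc i , suc j , cong (0 ∷_) eq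
  split₂ (suc zero ∷ w) q with split₁ w (cong ℕ.pred q)
  ... | j , eq = zero , suc j , cong (1 ∷_) (trans eq (sym (zero-+ (unit j))))
  split₂ (suc (suc zero) ∷ w) q =
    zero , zero , cong (2 ∷_) (trans (split₀ w (cong (λ m → ℕ.pred (ℕ.pred m)) q))
                                     (sym (zero-+ (replicate _ 0))))
  toΔ : ∀ {i j} → v ≡ zipWith ℕ._+_ (unit i) (unit j) → (v ⊣ [ p ]) ≡ e i ⊕ e j
  toΔ refl = refl

-- In the exchange, α′ = α − e i + e j and β′ = β − e j + e i, written without
-- subtraction.
record IsMConvex {n d} {a} (S : Pred (Δ n d) a) : Set a where
  field
    nonempty : Satisfiable S
    exchange : ∀ {α β} → S α → S β → ∀ i → β at i ℕ.< α at i →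
               ∃[ j ] (α at j ℕ.< β at j ×
                 (∃[ α′ ] (S α′ × α′ ⊕ e i ≡ α ⊕ e j)) ×
                 (∃[ β′ ] (S β′ × β′ ⊕ e j ≡ β ⊕ e i)))

------------------------------------------------------------------------

module Lorentzian {c ℓ : Level} (ℝ : RealNumbers c ℓ) where

  open RealNumbers ℝ public

  Matrix : ℕ → Set c
  Matrix n = Fin n → Fin n → Carrier

  IsEigenvector : ∀ {n} → Matrix n → Carrier → (Fin n → Carrier) → Set ℓ
  IsEigenvector H λ′ u =
    (∃[ i ] ¬ (u i ≈ 0#)) × (∀ i → ∑ (λ j → H i j * u j) ≈ λ′ * u i)

  LinearlyIndependent : ∀ {n} → (u v : Fin n → Carrier) → Set (c ⊔ ℓ)
  LinearlyIndependent u v =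
    ∀ a b → (∀ i → a * u i + b * v i ≈ 0#) → a ≈ 0# × b ≈ 0#

  -- For symmetric H, with eigenvalues counted with multiplicity: eigenvectors
  -- for distinct eigenvalues are independent, and the multiplicity of an
  -- eigenvalue is the dimension of its eigenspace.
  AtMostOnePositiveEigenvalue : ∀ {n} → Matrix n → Set (c ⊔ ℓ)
  AtMostOnePositiveEigenvalue H =
    ∀ {λ′ μ u v} → IsEigenvector H λ′ u → IsEigenvector H μ v →
    0# < λ′ → 0# < μ → ¬ LinearlyIndependent u v

  -- The polynomial Σ c_α x^α / α! is represented by the family of its
  -- normalized coefficients c_α.
  Polynomial : ℕ → ℕ → Set c
  Polynomial n d = Δ n d → Carrier

  support : ∀ {n d} → Polynomial n d → Pred (Δ n d) ℓ
  support f α = ¬ (f α ≈ 0#)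

  -- The Hessian of ∂^β f.
  hessian : ∀ {n k} → Polynomial n (2 ℕ.+ k) → Δ n k → Matrix n
  hessian f β i j = f (e i ⊕ e j ⊕ β)

  record IsLorentzian {n k} (f : Polynomial n (2 ℕ.+ k)) : Set (c ⊔ ℓ) where
    field
      nonneg   : ∀ α → 0# ≤ f α
      nonzero  : Satisfiable (support f)
      M-convex : IsMConvex (support f)
      hess     : ∀ β → AtMostOnePositiveEigenvalue (hessian f β)

  𝓛⁺ : ∀ {n k} → Subset n (2 ℕ.+ k) → Pred (Polynomial n (2 ℕ.+ k)) (c ⊔ ℓ)
  𝓛⁺ S f = IsLorentzian f × (∀ α → (0# < f α) ⇔ T (S α))

  ℝ^ : ∀ {n d} → Subset n d → Set c
  ℝ^ S = Elem S → Carrier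

  R : ∀ {n d} {S : Subset n d} → ℝ^ S → Polynomial n d → Carrier
  R {S = S} w f = ∏[ elements S ] λ α → f (value α) ^ w α

  BR : ∀ {n k} (S : Subset n (2 ℕ.+ k)) → Pred (ℝ^ S) (c ⊔ ℓ)
  BR S w = ∃[ M ] (∀ f → f ∈ 𝓛⁺ S → R w f ≤ M)

  ε : ∀ {n d} → Δ n d → Δ n d → Carrier
  ε α α′ = if ⌊ α ≟Δ α′ ⌋ then 1# else 0#

  -- ṽ^β
  extend : ∀ {n k} {S : Subset n (2 ℕ.+ k)} (β : Δ n k) → ℝ^ (link S β) → ℝ^ S
  extend {S = S} β v α =
    ∑[ elements (link S β) ] λ γ → v γ * ε (value γ ⊕ β) (value α)

  𝓖 : ∀ {n k} (S : Subset n (2 ℕ.+ k)) → Pred (ℝ^ S) (c ⊔ ℓ)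
  𝓖 S w = ∃[ β ] (Elem (link S β) ×
          ∃[ v ] (v ∈ BR (link S β) × (∀ α → w α ≈ extend β v α)))

  Cone : ∀ {n d a} {S : Subset n d} → Pred (ℝ^ S) a → Pred (ℝ^ S) (c ⊔ ℓ ⊔ a)
  Cone {S = S} E w =
    ∃[ m ] Σ[ t ∈ (Fin m → Carrier) ] Σ[ v ∈ (Fin m → ℝ^ S) ]
      ((∀ i → 0# ≤ t i) × (∀ i → v i ∈ E) ×
       (∀ α → w α ≈ ∑ (λ i → t i * v i α)))

  numerator₅ denominator₅ : List (Δ 5 3)
  numerator₅ =
    ⟦ 3 ∷ 0 ∷ 0 ∷ 0 ∷ 0 ∷ [] ⟧ ∷
    ⟦ 2 ∷ 1 ∷ 0 ∷ 0 ∷ 0 ∷ [] ⟧ ∷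
    ⟦ 1 ∷ 0 ∷ 1 ∷ 0 ∷ 1 ∷ [] ⟧ ∷
    ⟦ 0 ∷ 0 ∷ 2 ∷ 1 ∷ 0 ∷ [] ⟧ ∷
    ⟦ 0 ∷ 0 ∷ 0 ∷ 2 ∷ 1 ∷ [] ⟧ ∷ []
  denominator₅ =
    ⟦ 2 ∷ 0 ∷ 1 ∷ 0 ∷ 0 ∷ [] ⟧ ∷
    ⟦ 2 ∷ 0 ∷ 0 ∷ 1 ∷ 0 ∷ [] ⟧ ∷
    ⟦ 2 ∷ 0 ∷ 0 ∷ 0 ∷ 1 ∷ [] ⟧ ∷
    ⟦ 0 ∷ 1 ∷ 1 ∷ 1 ∷ 0 ∷ [] ⟧ ∷
    ⟦ 0 ∷ 0 ∷ 1 ∷ 1 ∷ 1 ∷ [] ⟧ ∷ []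

  R₅ : Polynomial 5 3 → Carrier
  R₅ f = ∏[ numerator₅ ] f ÷ ∏[ denominator₅ ] f

  w₅ : ℝ^ (full {5} {3})
  w₅ α = ∑[ numerator₅ ] (λ ν → ε ν (value α)) - ∑[ denominator₅ ] (λ δ → ε δ (value α))

{-# OPTIONS --safe #-}

-- The bound.  By the spectral theorem a symmetric matrix H with at most one
-- positive eigenvalue satisfies the reverse Cauchy–Schwarz inequality
-- (xᵀHx)(yᵀHy) ≤ (xᵀHy)² whenever xᵀHx > 0.  Test vectors supported on two
-- coordinates give, when all entries are positive, Hᵢᵢ Hⱼₖ ≤ 2 Hᵢⱼ Hᵢₖ and
-- Hᵢⱼ Hₖₗ ≤ 4 max (Hᵢₖ Hⱼₗ, Hᵢₗ Hⱼₖ).  Writing the variables as a, …, e, the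
-- product of aab·acd ≤ 4 aad·abc with three inequalities of the first kind is
-- R₅ ≤ 32, and so is the product of aab·acd ≤ 4 aac·abd with three others;
-- one of the two always applies.
--
-- The separation.  If t ↦ exp (t m) is a family of Lorentzian quadratic
-- polynomials for t ≥ 0, then ⟨v , m⟩ ≤ 0 for every bounded ratio v.  This
-- applies to split metrics m, hence to their sums, although a sum of split
-- metrics need not be M-concave.  A functional on Δ₅³ all of whose links are
-- such sums is therefore ≤ 0 on the cone of local generators, and one of them
-- is positive on w₅.
module Submission where

open import Algebra.Bundles using (RawRing)
import Algebra.Properties.AbelianGroup as AbelianGroupProperties
import Algebra.Properties.Ring as RingProperties
import Algebra.Properties.Semiring.Mult as SemiringMult
import Algebra.Properties.Semiring.Mult.TCOptimised as TCOptimised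
import Algebra.Properties.Semiring.Sum as SemiringSum
import Algebra.Solver.CommutativeMonoid as MonoidSolver
import Algebra.Solver.Ring as RingSolver
open import Algebra.Solver.Ring.AlmostCommutativeRing
  using (fromCommutativeRing; _-Raw-AlmostCommutative⟶_)
open import Data.Bool.Base using (Bool; true; false; if_then_else_; not; _xor_)
open import Data.Empty using (⊥; ⊥-elim)
open import Data.Fin.Base using (Fin; zero; suc)
import Data.Fin.Properties as Finₚ
open import Data.Irrelevant using ([_])
open import Data.List.Base as List using (List; []; _∷_; mapMaybe)
open import Data.List.Membership.Propositional using () renaming (_∈_ to _∈ₗ_)
import Data.List.Properties as Listₚ
open import Data.List.Relation.Unary.All as All using (All; []; _∷_)
open import Data.List.Relation.Unary.Any using (here; there)
open import Data.List.Relation.Unary.Unique.Propositional using (Unique; []; _∷_)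
open import Data.Maybe.Base as Maybe using (Maybe; just)
open import Data.Nat.Base as ℕ using (ℕ; zero; suc)
import Data.Nat.ListAction as ListAction
import Data.Nat.Properties as ℕₚ
open import Data.Product.Base using (_×_; _,_; proj₁; proj₂; ∃-syntax)
open import Data.Refinement.Base using (value) renaming (_,_ to _⊣_)
open import Data.Sum.Base as Sum using (_⊎_; inj₁; inj₂; [_,_]′)
open import Data.Unit.Base using (tt)
open import Data.Vec.Base as Vec
  using (Vec; []; _∷_; zipWith; lookup; updateAt; replicate)
open import Data.Vec.Functional using () renaming (_∷_ to _◂_; tail to tailᶠ)
import Data.Vec.Properties as Vecₚ
open import Function.Base using (_∘_)
open import Function.Bundles using (Equivalence; mk⇔)
open import Level using (Level; _⊔_)
open import Relation.Binary.Bundles using (StrictTotalOrder)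
import Relation.Binary.Construct.StrictToNonStrict as StrictToNonStrict
open import Relation.Binary.Definitions using (tri<; tri≈; tri>)
open import Relation.Binary.PropositionalEquality as ≡ using (_≡_)
import Relation.Binary.Reasoning.StrictPartialOrder as StrictReasoning
open import Relation.Binary.Structures using (IsStrictTotalOrder)
open import Relation.Nullary using (¬_; Dec; yes; no)
open import Relation.Nullary.Decidable
  using (dec⇒maybe; recompute; _⊎-dec_; _×-dec_; map′; toWitness)
open import Relation.Unary using (Pred; _∈_; _∉_; _∖_; _⊆_; _⊂_)
open import Defs

-- The hypothesis on a Hessian speaks of eigenvectors only, so a failure of reverse Cauchy-Schwarz
-- has to be turned into two independent eigenvectors. Completeness supplies a least upper bound of
-- the Rayleigh quotient. That it is attained is proved by elimination instead of compactness: a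
-- semidefinite form has a null vector or is bounded below by a positive multiple of the norm, and
-- the second case would lower the supremum.
--
-- The ratio escapes the local cone because the step aab·acd ≤ 4 max (aad·abc, aac·abd) is a
-- disjunction. Neither alternative is a bounded ratio of the link of a: the splits {a,d} against
-- {b,c} and {a,c} against {b,d} make the respective quotient unbounded. The three companion
-- inequalities are chosen per alternative so that both products end in the same ratio. The
-- separating functional is tight on all companions and violates both alternatives by the same
-- amount.

pattern ia = zero
pattern ib = suc zero
pattern ic = suc (suc zero)
pattern id = suc (suc (suc zero))
pattern ie = suc (suc (suc (suc zero)))

-- Arithmetic in an ordered field.

module OrderedField {c ℓ : Level} (ℝ : RealNumbers c ℓ) where

  open RealNumbers ℝ hiding (zero)
  open IsStrictTotalOrder isStrictTotalOrder public
    using (compare; irrefl; <-respˡ-≈; <-respʳ-≈)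
    renaming (trans to <-trans; asym to <-asym)
  open RingProperties ring public
    using (-‿distribˡ-*; -‿involutive; -0#≈0#)
  open AbelianGroupProperties +-abelianGroup using (⁻¹-∙-comm)
  open SemiringMult semiring public
    using (×1-homo-*; ×-homo-+; ×-congˡ)

  strictTotalOrder : StrictTotalOrder c ℓ ℓ
  strictTotalOrder = record { isStrictTotalOrder = isStrictTotalOrder }

  open StrictReasoning (StrictTotalOrder.strictPartialOrder strictTotalOrder) public

  private
    module Order = StrictToNonStrict _≈_ _<_

  ≤-trans : ∀ {x y z} → x ≤ y → y ≤ z → x ≤ z
  ≤-trans = Order.trans isEquivalence
    (IsStrictTotalOrder.<-resp-≈ isStrictTotalOrder) <-trans

  <-≤-trans : ∀ {x y z} → x < y → y ≤ z → x < z
  <-≤-trans = Order.<-≤-trans <-trans <-respʳ-≈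

  ≤-<-trans : ∀ {x y z} → x ≤ y → y < z → x < z
  ≤-<-trans = Order.≤-<-trans sym <-trans <-respˡ-≈

  ≤-total : ∀ x y → x ≤ y ⊎ y ≤ x
  ≤-total = Order.total compare

  ≤-<-absurd : ∀ {x y} → x ≤ y → ¬ (y < x)
  ≤-<-absurd p q = irrefl refl (≤-<-trans p q)

  -- A solver whose coefficients are formal differences of natural numbers,
  -- so that cancellation is decided by computation.
  private
    infix 8 _∸ᶠ_
    record Difference : Set where
      constructor _∸ᶠ_
      field positive negative : ℕ

    canonical : ℕ → ℕ → Difference
    canonical zero    b       = 0 ∸ᶠ b
    canonical (suc a) zero    = suc a ∸ᶠ 0
    canonical (suc a) (suc b) = canonical a b

    differences : RawRing _ _
    differences = record
      { Carrier = Difference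
      ; _≈_     = _≡_
      ; _+_     = λ { (a ∸ᶠ b) (c ∸ᶠ d) → canonical (a ℕ.+ c) (b ℕ.+ d) }
      ; _*_     = λ { (a ∸ᶠ b) (c ∸ᶠ d) →
                      canonical (a ℕ.* c ℕ.+ b ℕ.* d) (a ℕ.* d ℕ.+ b ℕ.* c) }
      ; -_      = λ { (a ∸ᶠ b) → b ∸ᶠ a }
      ; 0#      = 0 ∸ᶠ 0
      ; 1#      = 1 ∸ᶠ 0
      }

    open TCOptimised semiring using (×ᵤ≈×) renaming (_×_ to _·_)

    -- The case split makes the constants 0, 1 and 2 of the solver denote 0#,
    -- 1# and 1# + 1# on the nose.
    ⟦_⟧ᵈ : Difference → Carrier
    ⟦ a ∸ᶠ zero  ⟧ᵈ = a · 1#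
    ⟦ a ∸ᶠ suc b ⟧ᵈ = fromℕ a - fromℕ (suc b)

    ⟦⟧ᵈ-difference : ∀ a b → ⟦ a ∸ᶠ b ⟧ᵈ ≈ fromℕ a - fromℕ b
    ⟦⟧ᵈ-difference a zero    = trans (sym (×ᵤ≈× a 1#))
      (sym (trans (+-congˡ -0#≈0#) (+-identityʳ _)))
    ⟦⟧ᵈ-difference a (suc b) = refl

    -distrib : ∀ x y → - (x + y) ≈ - x + - y
    -distrib x y = sym (⁻¹-∙-comm x y)

    interchange : ∀ a b c d → (a + b) + (c + d) ≈ (a + c) + (b + d)
    interchange a b c d = begin-equality
      (a + b) + (c + d)   ≈⟨ +-assoc a b (c + d) ⟩
      a + (b + (c + d))   ≈⟨ +-congˡ (+-assoc b c d) ⟨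
      a + ((b + c) + d)   ≈⟨ +-congˡ (+-congʳ (+-comm b c)) ⟩
      a + ((c + b) + d)   ≈⟨ +-congˡ (+-assoc c b d) ⟩
      a + (c + (b + d))   ≈⟨ +-assoc a c (b + d) ⟨
      (a + c) + (b + d)   ∎

    ⟦canonical⟧ : ∀ a b → ⟦ canonical a b ⟧ᵈ ≈ fromℕ a - fromℕ b
    ⟦canonical⟧ zero    b       = ⟦⟧ᵈ-difference 0 b
    ⟦canonical⟧ (suc a) zero    = ⟦⟧ᵈ-difference (suc a) 0
    ⟦canonical⟧ (suc a) (suc b) = begin-equality
      ⟦ canonical a b ⟧ᵈ                    ≈⟨ ⟦canonical⟧ a b ⟩
      fromℕ a - fromℕ b                     ≈⟨ +-identityˡ _ ⟨
      0# + (fromℕ a - fromℕ b)              ≈⟨ +-congʳ (-‿inverseʳ 1#) ⟨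
      (1# - 1#) + (fromℕ a - fromℕ b)       ≈⟨ interchange _ _ _ _ ⟩
      fromℕ (suc a) + (- 1# - fromℕ b)      ≈⟨ +-congˡ (-distrib _ _) ⟨
      fromℕ (suc a) - fromℕ (suc b)         ∎

    via-differences : ∀ {x y} a b → fromℕ a - fromℕ b ≈ y → x ≈ y → ⟦ canonical a b ⟧ᵈ ≈ x
    via-differences a b p q = trans (⟦canonical⟧ a b) (trans p (sym q))

    *-distrib-- : ∀ a b c d → (a - b) * (c - d) ≈ (a * c + b * d) - (a * d + b * c)
    *-distrib-- a b c d = begin-equality
      (a - b) * (c - d)
        ≈⟨ distribʳ (c - d) a (- b) ⟩
      a * (c - d) + (- b) * (c - d)
        ≈⟨ +-cong (distribˡ a c (- d)) (distribˡ (- b) c (- d)) ⟩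
      (a * c + a * (- d)) + ((- b) * c + (- b) * (- d))
        ≈⟨ +-cong (+-congˡ (sym (RingProperties.-‿distribʳ-* ring a d)))
                  (+-cong (sym (-‿distribˡ-* b c)) neg-neg) ⟩
      (a * c + - (a * d)) + (- (b * c) + b * d)
        ≈⟨ +-congˡ (+-comm _ _) ⟩
      (a * c + - (a * d)) + (b * d + - (b * c))
        ≈⟨ interchange _ _ _ _ ⟩
      (a * c + b * d) + (- (a * d) + - (b * c))
        ≈⟨ +-congˡ (-distrib _ _) ⟨
      (a * c + b * d) - (a * d + b * c) ∎
      where
      neg-neg : (- b) * (- d) ≈ b * d
      neg-neg = trans (sym (-‿distribˡ-* b (- d)))
        (trans (-‿cong (sym (RingProperties.-‿distribʳ-* ring b d))) (-‿involutive _))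

    morphism : differences -Raw-AlmostCommutative⟶ fromCommutativeRing commutativeRing
    morphism = record
      { ⟦_⟧    = ⟦_⟧ᵈ
      ; +-homo = λ { (a ∸ᶠ b) (c ∸ᶠ d) → via-differences (a ℕ.+ c) (b ℕ.+ d)
          (trans (+-cong (×-homo-+ 1# a c)
                         (trans (-‿cong (×-homo-+ 1# b d)) (-distrib _ _)))
                 (interchange _ _ _ _))
          (+-cong (⟦⟧ᵈ-difference a b) (⟦⟧ᵈ-difference c d)) }
      ; *-homo = λ { (a ∸ᶠ b) (c ∸ᶠ d) →
          via-differences (a ℕ.* c ℕ.+ b ℕ.* d) (a ℕ.* d ℕ.+ b ℕ.* c)
          (trans (+-cong
                   (trans (×-homo-+ 1# (a ℕ.* c) (b ℕ.* d))
                          (+-cong (×1-homo-* a c) (×1-homo-* b d)))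
                   (-‿cong (trans (×-homo-+ 1# (a ℕ.* d) (b ℕ.* c))
                                  (+-cong (×1-homo-* a d) (×1-homo-* b c)))))
                 (sym (*-distrib-- _ _ _ _)))
          (*-cong (⟦⟧ᵈ-difference a b) (⟦⟧ᵈ-difference c d)) }
      ; -‿homo = λ { (a ∸ᶠ b) → trans (⟦⟧ᵈ-difference b a) (trans
          (trans (+-comm _ _)
                 (trans (+-congˡ (sym (-‿involutive _))) (sym (-distrib _ _))))
          (-‿cong (sym (⟦⟧ᵈ-difference a b)))) }
      ; 0-homo = refl
      ; 1-homo = refl
      }

    cross-equal : ∀ {w x y z} → w + z ≈ y + x → w - x ≈ y - z
    cross-equal {w} {x} {y} {z} eq = begin-equality
      w - x                   ≈⟨ +-identityʳ _ ⟨
      (w - x) + 0#            ≈⟨ +-congˡ (-‿inverseʳ z) ⟨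
      (w - x) + (z - z)       ≈⟨ interchange _ _ _ _ ⟩
      (w + z) + (- x - z)     ≈⟨ +-congʳ eq ⟩
      (y + x) + (- x - z)     ≈⟨ +-congˡ (+-comm _ _) ⟩
      (y + x) + (- z - x)     ≈⟨ interchange _ _ _ _ ⟩
      (y - z) + (x - x)       ≈⟨ +-congˡ (-‿inverseʳ x) ⟩
      (y - z) + 0#            ≈⟨ +-identityʳ _ ⟩
      y - z                   ∎

    _≟ᵈ_ : ∀ x y → Maybe (⟦ x ⟧ᵈ ≈ ⟦ y ⟧ᵈ)
    (a ∸ᶠ b) ≟ᵈ (c ∸ᶠ d) = Maybe.map
      (λ eq → trans (⟦⟧ᵈ-difference a b) (trans
        (cross-equal (trans (sym (×-homo-+ 1# a d))
                            (trans (×-congˡ eq) (×-homo-+ 1# c b))))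
        (sym (⟦⟧ᵈ-difference c d))))
      (dec⇒maybe (a ℕ.+ d ℕₚ.≟ c ℕ.+ b))

  open RingSolver differences (fromCommutativeRing commutativeRing) morphism _≟ᵈ_ public
    using (solve; _:=_; _:+_; _:*_; :-_; _:-_; con)
    renaming (Polynomial to Expression)

  κ : ∀ {n} → ℕ → Expression n
  κ m = con (m ∸ᶠ 0)

  2# : Carrier
  2# = 1# + 1#

  -- The certificate rule for polynomial inequalities: the gap `d` is exhibited as a visibly
  -- nonnegative expression, often with squares, and the remaining identity is left to the solver.
  ≤-by : ∀ {x y} d → 0# ≤ d → y ≈ x + d → x ≤ y
  ≤-by {x} d (inj₁ 0<d) y≈x+d = inj₁ (begin-strict
    x      ≈⟨ +-identityˡ x ⟨
    0# + x <⟨ +-monoˡ-< x 0<d ⟩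
    d + x  ≈⟨ +-comm d x ⟩
    x + d  ≈⟨ y≈x+d ⟨
    _      ∎)
  ≤-by {x} d (inj₂ 0≈d) y≈x+d =
    inj₂ (sym (trans y≈x+d (trans (+-congˡ (sym 0≈d)) (+-identityʳ x))))

  <-by : ∀ {x y} d → 0# < d → y ≈ x + d → x < y
  <-by {x} d 0<d y≈x+d = begin-strict
    x      ≈⟨ +-identityˡ x ⟨
    0# + x <⟨ +-monoˡ-< x 0<d ⟩
    d + x  ≈⟨ +-comm d x ⟩
    x + d  ≈⟨ y≈x+d ⟨
    _      ∎

  x<y⇒0<y-x : ∀ {x y} → x < y → 0# < y - x
  x<y⇒0<y-x {x} {y} x<y = begin-strict
    0#    ≈⟨ -‿inverseʳ x ⟨
    x - x <⟨ +-monoˡ-< (- x) x<y ⟩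
    y - x ∎

  x≤y⇒0≤y-x : ∀ {x y} → x ≤ y → 0# ≤ y - x
  x≤y⇒0≤y-x (inj₁ x<y) = inj₁ (x<y⇒0<y-x x<y)
  x≤y⇒0≤y-x (inj₂ x≈y) = inj₂ (trans (sym (-‿inverseʳ _)) (+-congʳ x≈y))

  ≮⇒≥ : ∀ {x y} → ¬ (x < y) → y ≤ x
  ≮⇒≥ {x} {y} x≮y with compare x y
  ... | tri< x<y _ _ = ⊥-elim (x≮y x<y)
  ... | tri≈ _ x≈y _ = inj₂ (sym x≈y)
  ... | tri> _ _ y<x = inj₁ y<x

  >⇒≉ : ∀ {x} → 0# < x → ¬ (x ≈ 0#)
  >⇒≉ 0<x x≈0 = irrefl (sym x≈0) 0<x

  +-mono-≤ : ∀ {w x y z} → w ≤ x → y ≤ z → w + y ≤ x + z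
  +-mono-≤ {w} {x} {y} {z} w≤x y≤z = ≤-trans (mono y w≤x)
    (≤-trans (inj₂ (+-comm x y)) (≤-trans (mono x y≤z) (inj₂ (+-comm z x))))
    where
    mono : ∀ {u v} t → u ≤ v → u + t ≤ v + t
    mono t (inj₁ u<v) = inj₁ (+-monoˡ-< t u<v)
    mono t (inj₂ u≈v) = inj₂ (+-congʳ u≈v)

  nonneg-+ : ∀ {x y} → 0# ≤ x → 0# ≤ y → 0# ≤ x + y
  nonneg-+ p q = ≤-trans (inj₂ (sym (+-identityˡ 0#))) (+-mono-≤ p q)

  pos-+ : ∀ {x y} → 0# < x → 0# ≤ y → 0# < x + y
  pos-+ {x} {y} p q = <-≤-trans p (≤-by y q refl)

  nonneg-* : ∀ {x y} → 0# ≤ x → 0# ≤ y → 0# ≤ x * y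
  nonneg-* (inj₁ p) (inj₁ q) = inj₁ (*-pos p q)
  nonneg-* (inj₂ p) _        = inj₂ (sym (trans (*-congʳ (sym p)) (zeroˡ _)))
  nonneg-* (inj₁ _) (inj₂ q) = inj₂ (sym (trans (*-congˡ (sym q)) (zeroʳ _)))

  *-monoˡ-≤ : ∀ {x y z} → 0# ≤ z → x ≤ y → z * x ≤ z * y
  *-monoˡ-≤ {x} {y} {z} p q = ≤-by (z * (y - x)) (nonneg-* p (x≤y⇒0≤y-x q))
    (solve 3 (λ x y z → z :* y := z :* x :+ z :* (y :- x)) refl x y z)

  *-mono-≤ : ∀ {w x y z} → 0# ≤ w → 0# ≤ z → w ≤ x → y ≤ z → w * y ≤ x * z
  *-mono-≤ {w} {x} {y} {z} 0≤w 0≤z w≤x y≤z = ≤-trans (*-monoˡ-≤ 0≤w y≤z)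
    (≤-trans (inj₂ (*-comm w z)) (≤-trans (*-monoˡ-≤ 0≤z w≤x) (inj₂ (*-comm z x))))

  *-monoˡ-< : ∀ {x y z} → 0# < z → x < y → z * x < z * y
  *-monoˡ-< {x} {y} {z} p q = <-by (z * (y - x)) (*-pos p (x<y⇒0<y-x q))
    (solve 3 (λ x y z → z :* y := z :* x :+ z :* (y :- x)) refl x y z)

  *-cancelˡ-≤ : ∀ {x y z} → 0# < z → z * x ≤ z * y → x ≤ y
  *-cancelˡ-≤ p q = ≮⇒≥ λ y<x → ≤-<-absurd q (*-monoˡ-< p y<x)

  *-cancelˡ-< : ∀ {x y z} → 0# < z → z * x < z * y → x < y
  *-cancelˡ-< {x} {y} p q with compare x y
  ... | tri< x<y _ _ = x<y
  ... | tri≈ _ x≈y _ = ⊥-elim (irrefl (*-congˡ x≈y) q)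
  ... | tri> _ _ y<x = ⊥-elim (<-asym q (*-monoˡ-< p y<x))

  *-cancelˡ-0 : ∀ {x z} → 0# < z → z * x ≈ 0# → x ≈ 0#
  *-cancelˡ-0 {x} {z} p q with compare x 0#
  ... | tri< x<0 _ _ = ⊥-elim (irrefl (trans q (sym (zeroʳ z))) (*-monoˡ-< p x<0))
  ... | tri≈ _ x≈0 _ = x≈0
  ... | tri> _ _ 0<x = ⊥-elim (irrefl (sym q) (*-pos p 0<x))

  neg-pos : ∀ {x} → x < 0# → 0# < - x
  neg-pos x<0 = <-respʳ-≈ (+-identityˡ _) (x<y⇒0<y-x x<0)

  square-pos : ∀ {x} → ¬ (x ≈ 0#) → 0# < x * x
  square-pos {x} x≉0 with compare x 0#
  ... | tri< x<0 _ _ = <-respʳ-≈ (solve 1 (λ x → (:- x) :* (:- x) := x :* x) refl x)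
                                 (*-pos (neg-pos x<0) (neg-pos x<0))
  ... | tri≈ _ x≈0 _ = ⊥-elim (x≉0 x≈0)
  ... | tri> _ _ 0<x = *-pos 0<x 0<x

  square-nonneg : ∀ x → 0# ≤ x * x
  square-nonneg x with compare x 0#
  ... | tri< _ x≉0 _ = inj₁ (square-pos x≉0)
  ... | tri≈ _ x≈0 _ = inj₂ (sym (trans (*-congʳ x≈0) (zeroˡ x)))
  ... | tri> _ x≉0 _ = inj₁ (square-pos x≉0)

  square≈0 : ∀ {x} → x * x ≈ 0# → x ≈ 0#
  square≈0 {x} xx≈0 with compare x 0#
  ... | tri< _ x≉0 _ = ⊥-elim (>⇒≉ (square-pos x≉0) xx≈0)
  ... | tri≈ _ x≈0 _ = x≈0
  ... | tri> _ x≉0 _ = ⊥-elim (>⇒≉ (square-pos x≉0) xx≈0)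

  ⁻¹-pos : ∀ {x} → 0# < x → 0# < x ⁻¹
  ⁻¹-pos {x} 0<x = *-cancelˡ-< 0<x
    (<-respˡ-≈ (sym (zeroʳ x)) (<-respʳ-≈ (sym (*-inverseʳ x (>⇒≉ 0<x))) 0<1))

  0<2 : 0# < 2#
  0<2 = pos-+ 0<1 (inj₁ 0<1)

  0≤1 : 0# ≤ 1#
  0≤1 = inj₁ 0<1

-- Bilinear forms and norms on coordinate vectors.

module QuadraticForms {c ℓ : Level} (ℝ : RealNumbers c ℓ) where

  open Lorentzian ℝ hiding (zero)
  open OrderedField ℝ
  open SemiringSum semiring public
    using (*-distribˡ-sum; *-distribʳ-sum; ∑-comm; ∑-distrib-+; sum-cong-≋)

  Symmetric : ∀ {n} → Matrix n → Set ℓ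
  Symmetric H = ∀ i j → H i j ≈ H j i

  dot : ∀ {n} → (Fin n → Carrier) → (Fin n → Carrier) → Carrier
  dot x y = ∑ λ i → x i * y i

  mul : ∀ {n} → Matrix n → (Fin n → Carrier) → Fin n → Carrier
  mul H x i = dot (H i) x

  form : ∀ {n} → Matrix n → (Fin n → Carrier) → (Fin n → Carrier) → Carrier
  form H x y = dot x (mul H y)

  combine : ∀ {a} {A : Set a} → Carrier → (A → Carrier) → Carrier → (A → Carrier) → A → Carrier
  combine a x b y i = a * x i + b * y i

  ∑-cong : ∀ {n} {f g : Fin n → Carrier} → (∀ i → f i ≈ g i) → ∑ f ≈ ∑ g
  ∑-cong = sum-cong-≋

  ∑-mono : ∀ {n} {f g : Fin n → Carrier} → (∀ i → f i ≤ g i) → ∑ f ≤ ∑ g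
  ∑-mono {zero}  f≤g = inj₂ refl
  ∑-mono {suc n} f≤g = +-mono-≤ (f≤g zero) (∑-mono λ i → f≤g (suc i))

  ∑-nonneg : ∀ {n} {f : Fin n → Carrier} → (∀ i → 0# ≤ f i) → 0# ≤ ∑ f
  ∑-nonneg {zero}  p = inj₂ refl
  ∑-nonneg {suc n} p = nonneg-+ (p zero) (∑-nonneg λ i → p (suc i))

  dot-cong : ∀ {n} {x x′ y y′ : Fin n → Carrier} →
             (∀ i → x i ≈ x′ i) → (∀ i → y i ≈ y′ i) → dot x y ≈ dot x′ y′
  dot-cong p q = ∑-cong λ i → *-cong (p i) (q i)

  dot-comm : ∀ {n} (x y : Fin n → Carrier) → dot x y ≈ dot y x
  dot-comm x y = ∑-cong λ i → *-comm (x i) (y i)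

  dot-linearʳ : ∀ {n} (z : Fin n → Carrier) a x b y →
                dot z (combine a x b y) ≈ a * dot z x + b * dot z y
  dot-linearʳ {zero}  z a x b y =
    solve 2 (λ a b → κ 0 := a :* κ 0 :+ b :* κ 0) refl a b
  dot-linearʳ {suc n} z a x b y = trans
    (+-congˡ (dot-linearʳ (λ i → z (suc i)) a (λ i → x (suc i)) b (λ i → y (suc i))))
    (solve 7 (λ a b z x y p q → z :* (a :* x :+ b :* y) :+ (a :* p :+ b :* q) :=
                                a :* (z :* x :+ p) :+ b :* (z :* y :+ q))
           refl a b (z zero) (x zero) (y zero) _ _)

  dot-linearˡ : ∀ {n} (z : Fin n → Carrier) a x b y →
                dot (combine a x b y) z ≈ a * dot x z + b * dot y z
  dot-linearˡ z a x b y = trans (dot-comm (combine a x b y) z) (trans (dot-linearʳ z a x b y)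
    (+-cong (*-congˡ (dot-comm z x)) (*-congˡ (dot-comm z y))))

  dot-scaleˡ : ∀ {n} (z : Fin n → Carrier) a x → dot (λ i → a * x i) z ≈ a * dot x z
  dot-scaleˡ {n} z a x = trans (∑-cong λ i → *-assoc a (x i) (z i))
                               (sym (*-distribˡ-sum a (λ i → x i * z i)))

  dot-scaleʳ : ∀ {n} (z : Fin n → Carrier) a x → dot z (λ i → a * x i) ≈ a * dot z x
  dot-scaleʳ z a x = trans (dot-comm z _) (trans (dot-scaleˡ z a x) (*-congˡ (dot-comm x z)))

  mul-combine : ∀ {n} a (M : Matrix n) b N x i →
                mul (λ i → combine a (M i) b (N i)) x i ≈ a * mul M x i + b * mul N x i
  mul-combine a M b N x i = dot-linearˡ x a (M i) b (N i)

  form-combine : ∀ {n} a (M : Matrix n) b N x y →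
                 form (λ i → combine a (M i) b (N i)) x y ≈ a * form M x y + b * form N x y
  form-combine a M b N x y = trans
    (dot-cong {x = x} (λ _ → refl) (mul-combine a M b N y))
    (dot-linearʳ x a (mul M y) b (mul N y))

  outer : ∀ {n} → (Fin n → Carrier) → (Fin n → Carrier) → Matrix n
  outer u v i j = u i * v j

  mul-outer : ∀ {n} (u v x : Fin n → Carrier) i → mul (outer u v) x i ≈ dot v x * u i
  mul-outer u v x i = trans (dot-scaleˡ x (u i) v) (*-comm _ _)

  form-outer : ∀ {n} (u v x y : Fin n → Carrier) → form (outer u v) x y ≈ dot x u * dot v y
  form-outer u v x y = trans
    (dot-cong {x = x} (λ _ → refl) (mul-outer u v y))
    (trans (dot-scaleʳ x (dot v y) u) (*-comm _ _))

  form-linearʳ : ∀ {n} (H : Matrix n) z a x b y →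
                 form H z (combine a x b y) ≈ a * form H z x + b * form H z y
  form-linearʳ H z a x b y = trans
    (dot-cong {x = z} (λ _ → refl) (λ i → dot-linearʳ (H i) a x b y))
    (dot-linearʳ z a (mul H x) b (mul H y))

  form-linearˡ : ∀ {n} (H : Matrix n) z a x b y →
                 form H (combine a x b y) z ≈ a * form H x z + b * form H y z
  form-linearˡ H z a x b y = dot-linearˡ (mul H z) a x b y

  form-comm : ∀ {n} {H : Matrix n} → Symmetric H → ∀ x y → form H x y ≈ form H y x
  form-comm {H = H} H-sym x y = begin-equality
    ∑ (λ i → x i * ∑ (λ j → H i j * y j))
      ≈⟨ ∑-cong (λ i → *-distribˡ-sum (x i) (λ j → H i j * y j)) ⟩
    ∑ (λ i → ∑ (λ j → x i * (H i j * y j)))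
      ≈⟨ ∑-comm (λ i j → x i * (H i j * y j)) ⟩
    ∑ (λ j → ∑ (λ i → x i * (H i j * y j)))
      ≈⟨ ∑-cong (λ j → ∑-cong λ i → trans (*-congˡ (*-congʳ (H-sym i j)))
           (solve 3 (λ x h y → x :* (h :* y) := y :* (h :* x)) refl (x i) (H j i) (y j))) ⟩
    ∑ (λ j → ∑ (λ i → y j * (H j i * x i)))
      ≈⟨ ∑-cong (λ j → *-distribˡ-sum (y j) (λ i → H j i * x i)) ⟨
    ∑ (λ j → y j * ∑ (λ i → H j i * x i)) ∎

  form-square : ∀ {n} {H : Matrix n} → Symmetric H → ∀ a x b y →
                form H (combine a x b y) (combine a x b y) ≈
                a * a * form H x x + 2# * (a * b) * form H x y + b * b * form H y y
  form-square {H = H} H-sym a x b y = begin-equality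
    form H (combine a x b y) (combine a x b y)
      ≈⟨ form-linearˡ H (combine a x b y) a x b y ⟩
    a * form H x (combine a x b y) + b * form H y (combine a x b y)
      ≈⟨ +-cong (*-congˡ (form-linearʳ H x a x b y)) (*-congˡ (form-linearʳ H y a x b y)) ⟩
    a * (a * form H x x + b * form H x y) + b * (a * form H y x + b * form H y y)
      ≈⟨ +-congˡ (*-congˡ (+-congʳ (*-congˡ (form-comm H-sym y x)))) ⟩
    a * (a * form H x x + b * form H x y) + b * (a * form H x y + b * form H y y)
      ≈⟨ solve 5 (λ a b p q r → a :* (a :* p :+ b :* q) :+ b :* (a :* q :+ b :* r) :=
                    a :* a :* p :+ κ 2 :* (a :* b) :* q :+ b :* b :* r)
               refl a b _ _ _ ⟩
    a * a * form H x x + 2# * (a * b) * form H x y + b * b * form H y y ∎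

  ∥_∥² : ∀ {n} → (Fin n → Carrier) → Carrier
  ∥ x ∥² = dot x x

  ∥∥²-nonneg : ∀ {n} (x : Fin n → Carrier) → 0# ≤ ∥ x ∥²
  ∥∥²-nonneg x = ∑-nonneg λ i → square-nonneg (x i)

  ∥∥²≈0 : ∀ {n} (x : Fin n → Carrier) → ∥ x ∥² ≈ 0# → ∀ i → x i ≈ 0#
  ∥∥²≈0 {suc n} x eq = λ where
      zero    → square≈0 (squeeze (square-nonneg (x zero)) tail≥0 eq)
      (suc i) → ∥∥²≈0 (tailᶠ x) (squeeze tail≥0 (square-nonneg (x zero)) (trans (+-comm _ _) eq)) i
    where
    tail≥0 = ∥∥²-nonneg (tailᶠ x)
    squeeze : ∀ {p q} → 0# ≤ p → 0# ≤ q → p + q ≈ 0# → p ≈ 0#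
    squeeze (inj₂ 0≈p) _ _ = sym 0≈p
    squeeze (inj₁ 0<p) q p+q≈0 = ⊥-elim (>⇒≉ (pos-+ 0<p q) p+q≈0)

  ∥∥²-pos : ∀ {n} (x : Fin n → Carrier) i → ¬ (x i ≈ 0#) → 0# < ∥ x ∥²
  ∥∥²-pos x i xi≉0 with ∥∥²-nonneg x
  ... | inj₁ 0<xx = 0<xx
  ... | inj₂ 0≈xx = ⊥-elim (xi≉0 (∥∥²≈0 x (sym 0≈xx) i))

  -- The identity matrix; its row `δ i` also serves as the i-th standard basis vector.
  δ : ∀ {n} → Matrix n
  δ zero    zero    = 1#
  δ zero    (suc j) = 0#
  δ (suc i) zero    = 0#
  δ (suc i) (suc j) = δ i j

  δ-refl : ∀ {n} (i : Fin n) → δ i i ≈ 1#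
  δ-refl zero    = refl
  δ-refl (suc i) = δ-refl i

  δ-sym : ∀ {n} → Symmetric (δ {n})
  δ-sym zero    zero    = refl
  δ-sym zero    (suc j) = refl
  δ-sym (suc i) zero    = refl
  δ-sym (suc i) (suc j) = δ-sym i j

  dot-zeroˡ : ∀ {n} (x : Fin n → Carrier) → dot (λ _ → 0#) x ≈ 0#
  dot-zeroˡ {zero}  x = refl
  dot-zeroˡ {suc n} x = trans (+-cong (zeroˡ _) (dot-zeroˡ (tailᶠ x))) (+-identityˡ 0#)

  dot-δˡ : ∀ {n} i (x : Fin n → Carrier) → dot (δ i) x ≈ x i
  dot-δˡ zero    x = trans (+-cong (*-identityˡ _) (dot-zeroˡ (tailᶠ x))) (+-identityʳ _)
  dot-δˡ (suc i) x = trans (+-cong (zeroˡ _) (dot-δˡ i (tailᶠ x))) (+-identityˡ _)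

  form-δ : ∀ {n} (H : Matrix n) i j → form H (δ i) (δ j) ≈ H i j
  form-δ H i j = trans (dot-δˡ i (mul H (δ j)))
    (trans (dot-comm (H i) (δ j)) (dot-δˡ j (H i)))

-- Semidefinite forms and elimination by Schur complements.

module Spectral {c ℓ : Level} (ℝ : RealNumbers c ℓ) where

  open Lorentzian ℝ hiding (zero)
  open OrderedField ℝ
  open QuadraticForms ℝ

  -- Cauchy-Schwarz with a crude constant, one coordinate at a time: (βξ + p)² ≤ 2β²ξ² + 2p². Only
  -- the existence of some constant matters later.
  dot-bounded : ∀ {n} (b : Fin n → Carrier) →
                ∃[ K ] (0# ≤ K × (∀ x → dot b x * dot b x ≤ K * ∥ x ∥²))
  dot-bounded {zero}  b = 0# , inj₂ refl , λ x → inj₂ refl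
  dot-bounded {suc n} b with dot-bounded (tailᶠ b)
  ... | K , 0≤K , bound = β * β + β * β + (K + K) ,
        nonneg-+ (nonneg-+ ββ≥0 ββ≥0) (nonneg-+ 0≤K 0≤K) , λ x →
        let ξ = x zero; p = dot (tailᶠ b) (tailᶠ x); N = ∥ tailᶠ x ∥² in
        ≤-by ((β * ξ - p) * (β * ξ - p) + 2# * (K * N - p * p)
              + (2# * K * (ξ * ξ) + 2# * (β * β) * N))
          (nonneg-+
            (nonneg-+ (square-nonneg _) (nonneg-* (inj₁ 0<2) (x≤y⇒0≤y-x (bound (tailᶠ x)))))
            (nonneg-+ (nonneg-* (nonneg-* (inj₁ 0<2) 0≤K) (square-nonneg ξ))
                      (nonneg-* (nonneg-* (inj₁ 0<2) ββ≥0) (∥∥²-nonneg (tailᶠ x)))))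
          (solve 5 (λ β ξ p K N →
             (β :* β :+ β :* β :+ (K :+ K)) :* (ξ :* ξ :+ N) :=
             (β :* ξ :+ p) :* (β :* ξ :+ p) :+
             ((β :* ξ :- p) :* (β :* ξ :- p) :+ κ 2 :* (K :* N :- p :* p) :+
              (κ 2 :* K :* (ξ :* ξ) :+ κ 2 :* (β :* β) :* N))) refl β ξ p K N)
    where
    β = b zero
    ββ≥0 = square-nonneg β

  -- Each summand satisfies xᵢ(Hx)ᵢ ≤ xᵢ² + (Hx)ᵢ², and the last square is controlled by
  -- `dot-bounded`. This bounds the Rayleigh quotients from above.
  form-bounded : ∀ {n} (H : Matrix n) → ∃[ B ] (0# ≤ B × (∀ x → form H x x ≤ B * ∥ x ∥²))
  form-bounded H = 1# + ∑ K , nonneg-+ 0≤1 (∑-nonneg λ i → proj₁ (proj₂ (dot-bounded (H i)))) ,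
    λ x → begin
      form H x x
        ≤⟨ ∑-mono (λ i → product≤squares (x i) (mul H x i)) ⟩
      ∑ (λ i → x i * x i + mul H x i * mul H x i)
        ≤⟨ ∑-mono (λ i → +-mono-≤ (inj₂ refl) (proj₂ (proj₂ (dot-bounded (H i))) x)) ⟩
      ∑ (λ i → x i * x i + K i * ∥ x ∥²)
        ≈⟨ ∑-distrib-+ (λ i → x i * x i) (λ i → K i * ∥ x ∥²) ⟩
      ∥ x ∥² + ∑ (λ i → K i * ∥ x ∥²)
        ≈⟨ +-cong (sym (*-identityˡ _)) (sym (*-distribʳ-sum ∥ x ∥² K)) ⟩
      1# * ∥ x ∥² + ∑ K * ∥ x ∥²
        ≈⟨ distribʳ _ _ _ ⟨
      (1# + ∑ K) * ∥ x ∥² ∎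
    where
    K = λ i → proj₁ (dot-bounded (H i))
    product≤squares : ∀ a b → a * b ≤ a * a + b * b
    product≤squares a b = *-cancelˡ-≤ 0<2
      (≤-by ((a - b) * (a - b) + (a * a + b * b))
        (nonneg-+ (square-nonneg _) (nonneg-+ (square-nonneg a) (square-nonneg b)))
        (solve 2 (λ a b → κ 2 :* (a :* a :+ b :* b) :=
           κ 2 :* (a :* b) :+ ((a :- b) :* (a :- b) :+ (a :* a :+ b :* b))) refl a b))

  PositiveSemidefinite : ∀ {n} → Matrix n → Set (c ⊔ ℓ)
  PositiveSemidefinite M = ∀ x → 0# ≤ form M x x

  NullVector : ∀ {n} → Matrix n → Set (c ⊔ ℓ)
  NullVector M = ∃[ x ] ((∃[ i ] ¬ (x i ≈ 0#)) × form M x x ≈ 0#)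

  -- The lower bound E/C on the unit sphere, kept as two constants so that the recursion through
  -- Schur complements stays free of division.
  UniformlyPositive : ∀ {n} → Matrix n → Set (c ⊔ ℓ)
  UniformlyPositive M =
    ∃[ E ] ∃[ C ] (0# < E × 0# < C × (∀ x → E * ∥ x ∥² ≤ C * form M x x))

  form-suc : ∀ {n} {M : Matrix (suc n)} → Symmetric M → ∀ x →
             let x₀ = x zero; x′ = tailᶠ x in
             form M x x ≈ M zero zero * (x₀ * x₀) + 2# * (x₀ * dot (tailᶠ (M zero)) x′)
                          + form (λ i j → M (suc i) (suc j)) x′ x′
  form-suc {M = M} M-sym x = trans
    (+-congˡ (trans (dot-cong {x = x′} (λ _ → refl) first-column)
             (trans (dot-linearʳ x′ x₀ b 1# (mul M′ x′)) (+-congʳ (*-congˡ (dot-comm x′ b))))))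
    (solve 4 (λ a ξ p q → ξ :* (a :* ξ :+ p) :+ (ξ :* p :+ κ 1 :* q) :=
                          a :* (ξ :* ξ) :+ κ 2 :* (ξ :* p) :+ q) refl (M zero zero) x₀ _ _)
    where
    x₀ = x zero
    x′ = tailᶠ x
    b  = tailᶠ (M zero)
    M′ = λ i j → M (suc i) (suc j)
    first-column : ∀ i → M (suc i) zero * x₀ + mul M′ x′ i ≈ combine x₀ b 1# (mul M′ x′) i
    first-column i = +-cong (trans (*-congʳ (M-sym (suc i) zero)) (*-comm _ _))
                            (sym (*-identityˡ _))

  -- The Schur complement of the pivot a = M₀₀ multiplied by a, that is aM′ - bbᵀ, where b is the
  -- rest of the first row.
  schur : ∀ {n} → Matrix (suc n) → Matrix n
  schur M i = combine (M zero zero) (λ j → M (suc i) (suc j))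
                      (- 1#) (outer (tailᶠ (M zero)) (tailᶠ (M zero)) i)

  schur-symmetric : ∀ {n} {M : Matrix (suc n)} → Symmetric M → Symmetric (schur M)
  schur-symmetric M-sym i j = +-cong (*-congˡ (M-sym (suc i) (suc j))) (*-congˡ (*-comm _ _))

  -- Completing the square, multiplied by the pivot to avoid division.
  form-schur : ∀ {n} {M : Matrix (suc n)} → Symmetric M → ∀ x →
               let a = M zero zero; l = a * x zero + dot (tailᶠ (M zero)) (tailᶠ x) in
               a * form M x x ≈ l * l + form (schur M) (tailᶠ x) (tailᶠ x)
  form-schur {M = M} M-sym x = begin-equality
    a * form M x x
      ≈⟨ *-congˡ (form-suc {M = M} M-sym x) ⟩
    a * (a * (x₀ * x₀) + 2# * (x₀ * p) + form M′ x′ x′)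
      ≈⟨ solve 4 (λ a ξ p q → a :* (a :* (ξ :* ξ) :+ κ 2 :* (ξ :* p) :+ q) :=
           (a :* ξ :+ p) :* (a :* ξ :+ p) :+ (a :* q :+ (:- κ 1) :* (p :* p))) refl a x₀ p _ ⟩
    (a * x₀ + p) * (a * x₀ + p) + (a * form M′ x′ x′ + - 1# * (p * p))
      ≈⟨ +-congˡ (+-congˡ (*-congˡ (trans (form-outer b b x′ x′) (*-congʳ (dot-comm x′ b))))) ⟨
    (a * x₀ + p) * (a * x₀ + p) + (a * form M′ x′ x′ + - 1# * form (outer b b) x′ x′)
      ≈⟨ +-congˡ (form-combine a M′ (- 1#) (outer b b) x′ x′) ⟨
    (a * x₀ + p) * (a * x₀ + p) + form (schur M) x′ x′ ∎
    where
    a  = M zero zero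
    x₀ = x zero
    x′ = tailᶠ x
    b  = tailᶠ (M zero)
    p  = dot b x′
    M′ = λ i j → M (suc i) (suc j)

  -- The vector (-b·x, ax), on which the completed square of `form-schur` vanishes, so that only the
  -- Schur complement contributes.
  schur-lift : ∀ {n} → Matrix (suc n) → (Fin n → Carrier) → Fin (suc n) → Carrier
  schur-lift M x = - dot (tailᶠ (M zero)) x ◂ λ i → M zero zero * x i

  form-schur-lift : ∀ {n} {M : Matrix (suc n)} → Symmetric M → ∀ x →
                    M zero zero * form M (schur-lift M x) (schur-lift M x) ≈
                    M zero zero * (M zero zero * form (schur M) x x)
  form-schur-lift {M = M} M-sym x = begin-equality
    a * form M (schur-lift M x) (schur-lift M x)
      ≈⟨ form-schur {M = M} M-sym (schur-lift M x) ⟩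
    (a * (- p) + dot b ax) * (a * (- p) + dot b ax) + form (schur M) ax ax
      ≈⟨ +-cong (*-cong l≈0 l≈0) form-scale ⟩
    0# * 0# + a * (a * form (schur M) x x)
      ≈⟨ solve 1 (λ q → κ 0 :* κ 0 :+ q := q) refl _ ⟩
    a * (a * form (schur M) x x) ∎
    where
    a = M zero zero
    b = tailᶠ (M zero)
    p = dot b x
    ax = λ i → a * x i
    l≈0 : a * (- p) + dot b ax ≈ 0#
    l≈0 = trans (+-congˡ (dot-scaleʳ b a x))
                (solve 2 (λ a p → a :* (:- p) :+ a :* p := κ 0) refl a p)
    form-scale : form (schur M) ax ax ≈ a * (a * form (schur M) x x)
    form-scale = trans (dot-scaleˡ (mul (schur M) ax) a x)
      (*-congˡ (trans (dot-cong {x = x} (λ _ → refl) (λ i → dot-scaleʳ (schur M i) a x))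
                      (dot-scaleʳ x a (mul (schur M) x))))

  schur-semidefinite : ∀ {n} {M : Matrix (suc n)} → Symmetric M → 0# < M zero zero →
                       PositiveSemidefinite M → PositiveSemidefinite (schur M)
  schur-semidefinite {M = M} M-sym 0<a M≥0 x = *-cancelˡ-≤ 0<a (*-cancelˡ-≤ 0<a (begin
    M zero zero * (M zero zero * 0#)
      ≈⟨ solve 1 (λ a → a :* (a :* κ 0) := a :* κ 0) refl (M zero zero) ⟩
    M zero zero * 0#
      ≤⟨ *-monoˡ-≤ (inj₁ 0<a) (M≥0 (schur-lift M x)) ⟩
    M zero zero * form M (schur-lift M x) (schur-lift M x)
      ≈⟨ form-schur-lift {M = M} M-sym x ⟩
    M zero zero * (M zero zero * form (schur M) x x) ∎))

  schur-null : ∀ {n} {M : Matrix (suc n)} → Symmetric M → 0# < M zero zero →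
               NullVector (schur M) → NullVector M
  schur-null {M = M} M-sym 0<a (x , (i , xi≉0) , null) =
    schur-lift M x , (suc i , λ axi≈0 → xi≉0 (*-cancelˡ-0 0<a axi≈0)) ,
    *-cancelˡ-0 0<a (trans (form-schur-lift {M = M} M-sym x)
      (trans (*-congˡ (trans (*-congˡ null) (zeroʳ _))) (zeroʳ _)))

  -- Completing the square gives a·form M x x = l² + q with l = ax₀ + p. Since (ax₀)² ≤ 2l² + 2p²,
  -- p² ≤ K‖x′‖² and E‖x′‖² ≤ Cq, both parts of the norm are controlled by l² and q; the two new
  -- constants collect these factors.
  schur-uniform : ∀ {n} {M : Matrix (suc n)} → Symmetric M → 0# < M zero zero →
                  UniformlyPositive (schur M) → UniformlyPositive M
  schur-uniform {n} {M} M-sym 0<a (E , C , 0<E , 0<C , bound) =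
    a * a * E , (2# * E + (2# * K + a * a) * C) * a ,
    *-pos (*-pos 0<a 0<a) 0<E , *-pos 0<D 0<a , bound-M
    where
    a = M zero zero
    b = tailᶠ (M zero)
    K : Carrier
    K = proj₁ (dot-bounded b)
    0≤K : 0# ≤ K
    0≤K = proj₁ (proj₂ (dot-bounded b))
    dot-bound : ∀ x → dot b x * dot b x ≤ K * ∥ x ∥²
    dot-bound = proj₂ (proj₂ (dot-bounded b))
    0<D : 0# < 2# * E + (2# * K + a * a) * C
    0<D = pos-+ (*-pos 0<2 0<E)
      (nonneg-* (nonneg-+ (nonneg-* (inj₁ 0<2) 0≤K) (square-nonneg a)) (inj₁ 0<C))
    bound-M : ∀ x → a * a * E * ∥ x ∥² ≤ (2# * E + (2# * K + a * a) * C) * a * form M x x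
    bound-M x = begin
      a * a * E * (x₀ * x₀ + N)
        ≈⟨ solve 4 (λ a E x₀ N → a :* a :* E :* (x₀ :* x₀ :+ N) :=
             E :* ((a :* x₀) :* (a :* x₀)) :+ a :* a :* (E :* N)) refl a E x₀ N ⟩
      E * (y * y) + a * a * (E * N)
        ≤⟨ +-mono-≤ (*-monoˡ-≤ (inj₁ 0<E) (≤-by ((l + p) * (l + p)) (square-nonneg _)
             (solve 2 (λ y p → κ 2 :* ((y :+ p) :* (y :+ p)) :+ κ 2 :* (p :* p) :=
                y :* y :+ ((y :+ p) :+ p) :* ((y :+ p) :+ p)) refl y p))) (inj₂ refl) ⟩
      E * (2# * (l * l) + 2# * (p * p)) + a * a * (E * N)
        ≤⟨ +-mono-≤ (*-monoˡ-≤ (inj₁ 0<E) (+-mono-≤ (inj₂ refl)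
             (*-monoˡ-≤ (inj₁ 0<2) (dot-bound x′)))) (inj₂ refl) ⟩
      E * (2# * (l * l) + 2# * (K * N)) + a * a * (E * N)
        ≈⟨ solve 5 (λ E L K N w → E :* (κ 2 :* L :+ κ 2 :* (K :* N)) :+ w :* (E :* N) :=
             κ 2 :* E :* L :+ (κ 2 :* K :+ w) :* (E :* N)) refl E (l * l) K N (a * a) ⟩
      2# * E * (l * l) + (2# * K + a * a) * (E * N)
        ≤⟨ +-mono-≤ (inj₂ refl) (*-monoˡ-≤ 0≤W (bound x′)) ⟩
      2# * E * (l * l) + (2# * K + a * a) * (C * q)
        ≤⟨ ≤-by (2# * E * q + (2# * K + a * a) * (C * (l * l)))
             (nonneg-+ (nonneg-* (nonneg-* (inj₁ 0<2) (inj₁ 0<E)) 0≤q)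
                       (nonneg-* 0≤W (nonneg-* (inj₁ 0<C) (square-nonneg l))))
             (solve 5 (λ E W C L q → (E :+ W :* C) :* (L :+ q) :=
                (E :* L :+ W :* (C :* q)) :+ (E :* q :+ W :* (C :* L)))
                refl (2# * E) (2# * K + a * a) C (l * l) q) ⟩
      (2# * E + (2# * K + a * a) * C) * (l * l + q)
        ≈⟨ *-congˡ (form-schur {M = M} M-sym x) ⟨
      (2# * E + (2# * K + a * a) * C) * (a * form M x x)
        ≈⟨ *-assoc _ _ _ ⟨
      (2# * E + (2# * K + a * a) * C) * a * form M x x ∎
      where
      x₀ = x zero
      x′ = tailᶠ x
      N  = ∥ x′ ∥²
      p  = dot b x′
      y  = a * x₀
      l  = y + p
      q  = form (schur M) x′ x′
      0≤W : 0# ≤ 2# * K + a * a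
      0≤W = nonneg-+ (nonneg-* (inj₁ 0<2) 0≤K) (square-nonneg a)
      0≤q : 0# ≤ q
      0≤q = *-cancelˡ-≤ 0<C (≤-trans (inj₂ (zeroʳ C))
              (≤-trans (nonneg-* (inj₁ 0<E) (∥∥²-nonneg x′)) (bound x′)))

  -- Induction on the size, in place of compactness of the sphere. A negative pivot contradicts
  -- semidefiniteness, a zero pivot makes the first basis vector null, and a positive pivot passes
  -- either alternative up from the Schur complement. In size 0 there is no nonzero vector, so any
  -- positive constants do.
  semidefinite-dichotomy : ∀ {n} {M : Matrix n} → Symmetric M → PositiveSemidefinite M →
                           NullVector M ⊎ UniformlyPositive M
  semidefinite-dichotomy {zero} M-sym M≥0 =
    inj₂ (1# , 1# , 0<1 , 0<1 , λ x → inj₂ refl)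
  semidefinite-dichotomy {suc n} {M} M-sym M≥0 with compare (M zero zero) 0#
  ... | tri< a<0 _ _ = ⊥-elim (≤-<-absurd (M≥0 (δ zero)) (<-respˡ-≈ (sym (form-δ M zero zero)) a<0))
  ... | tri≈ _ a≈0 _ = inj₁ (δ zero , (zero , >⇒≉ 0<1) , trans (form-δ M zero zero) a≈0)
  ... | tri> _ _ 0<a = Sum.map (schur-null M-sym 0<a) (schur-uniform M-sym 0<a)
    (semidefinite-dichotomy (schur-symmetric {M = M} M-sym)
                            (schur-semidefinite {M = M} M-sym 0<a M≥0))

  -- If w = Mx were nonzero, moving from a large multiple of -x slightly towards w would make the
  -- form negative: the x-part contributes 0, while the mixed term is linear in the multiple.
  null⇒kernel : ∀ {n} {M : Matrix n} → Symmetric M → PositiveSemidefinite M →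
                ∀ x → form M x x ≈ 0# → ∀ i → mul M x i ≈ 0#
  null⇒kernel {M = M} M-sym M≥0 x null with ∥∥²-nonneg (mul M x)
  ... | inj₂ 0≈r = ∥∥²≈0 (mul M x) (sym 0≈r)
  ... | inj₁ 0<r = ⊥-elim (≤-<-absurd (M≥0 z) (<-by (r * r * (p + 2#))
          (*-pos (*-pos 0<r 0<r) (<-respʳ-≈ (+-comm _ _) (pos-+ 0<2 (M≥0 w))))
          (begin-equality
          0#
            ≈⟨ solve 2 (λ r p → κ 0 :=
                 ((:- (p :+ κ 1)) :* (:- (p :+ κ 1)) :* κ 0 :+
                  κ 2 :* ((:- (p :+ κ 1)) :* r) :* r :+ r :* r :* p)
                 :+ r :* r :* (p :+ κ 2)) refl r p ⟩
          (α * α * 0# + 2# * (α * r) * r + r * r * p) + r * r * (p + 2#)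
            ≈⟨ +-congʳ (+-congʳ (+-cong (*-congˡ null) (*-congˡ (form-comm {H = M} M-sym x w)))) ⟨
          (α * α * form M x x + 2# * (α * r) * form M x w + r * r * p) + r * r * (p + 2#)
            ≈⟨ +-congʳ (form-square {H = M} M-sym α x r w) ⟨
          form M z z + r * r * (p + 2#) ∎)))
    where
    w = mul M x
    r = ∥ w ∥²
    p = form M w w
    -- Since form M x w = r, this choice gives form M z z = -2(p + 1)r² + r²p = -r²(p + 2) < 0.
    α = - (p + 1#)
    z = combine α x r w

-- Top eigenvectors and the reverse Cauchy-Schwarz inequality.

module Hodge {c ℓ : Level} (ℝ : RealNumbers c ℓ) where

  open Lorentzian ℝ hiding (zero)
  open OrderedField ℝ
  open QuadraticForms ℝ
  open Spectral ℝ

  form≤0 : ∀ {n} (H : Matrix n) x → ∥ x ∥² ≈ 0# → form H x x ≤ 0#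
  form≤0 H x N≈0 with form-bounded H
  ... | B , _ , bound = ≤-trans (bound x) (inj₂ (trans (*-congˡ N≈0) (zeroʳ B)))

  form-pos⇒norm-pos : ∀ {n} (H : Matrix n) x → 0# < form H x x → 0# < ∥ x ∥²
  form-pos⇒norm-pos H x 0<q with ∥∥²-nonneg x
  ... | inj₁ 0<N = 0<N
  ... | inj₂ 0≈N = ⊥-elim (≤-<-absurd (form≤0 H x (sym 0≈N)) 0<q)

  -- The supremum of the Rayleigh quotient, phrased without a quotient so that zero vectors need no
  -- exclusion.
  IsMaximalRatio : ∀ {n} → Matrix n → Carrier → Set (c ⊔ ℓ)
  IsMaximalRatio H μ = (∀ x → form H x x ≤ μ * ∥ x ∥²) ×
                       (∀ s → (∀ x → form H x x ≤ s * ∥ x ∥²) → μ ≤ s)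

  maximal-ratio : ∀ {n} (H : Matrix n) y → 0# < form H y y →
                  ∃[ μ ] (0# < μ × IsMaximalRatio H μ)
  maximal-ratio {n} H y 0<qy = from-supremum (sup Ratio (_ , ratio y 0<Ny) bounded)
    where
    -- All numbers below some Rayleigh quotient: the set has the same upper bounds as the quotients
    -- themselves, and its definition contains no inverse.
    Ratio : Carrier → Set (c ⊔ ℓ)
    Ratio s = ∃[ x ] (0# < ∥ x ∥² × s * ∥ x ∥² ≤ form H x x)
    cancel : ∀ q {N} → 0# < N → q ÷ N * N ≈ q
    cancel q {N} 0<N = trans (*-assoc q _ N) (trans
      (*-congˡ (trans (*-comm _ N) (*-inverseʳ N (>⇒≉ 0<N)))) (*-identityʳ q))
    ratio : ∀ x → 0# < ∥ x ∥² → Ratio (form H x x ÷ ∥ x ∥²)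
    ratio x 0<N = x , 0<N , inj₂ (cancel _ 0<N)
    0<Ny : 0# < ∥ y ∥²
    0<Ny = form-pos⇒norm-pos H y 0<qy
    upper-bound : ∀ {s} → (∀ x → form H x x ≤ s * ∥ x ∥²) → UpperBound Ratio s
    upper-bound {s} bound {t} (x , 0<N , tN≤q) = *-cancelˡ-≤ 0<N (begin
      ∥ x ∥² * t  ≈⟨ *-comm _ t ⟩
      t * ∥ x ∥²  ≤⟨ tN≤q ⟩
      form H x x  ≤⟨ bound x ⟩
      s * ∥ x ∥²  ≈⟨ *-comm s _ ⟩
      ∥ x ∥² * s  ∎)
    bounded : ∃[ b ] UpperBound Ratio b
    bounded = proj₁ (form-bounded H) , upper-bound (proj₂ (proj₂ (form-bounded H)))
    from-supremum : ∃[ s ] (UpperBound Ratio s × (∀ {b} → UpperBound Ratio b → s ≤ b)) →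
                    ∃[ μ ] (0# < μ × IsMaximalRatio H μ)
    from-supremum (μ , upper , least) =
      μ , <-≤-trans (*-pos 0<qy (⁻¹-pos 0<Ny)) (upper (ratio y 0<Ny)) ,
      maximal , λ s bound → least (upper-bound bound)
      where
      maximal : ∀ x → form H x x ≤ μ * ∥ x ∥²
      maximal x = [ (λ 0<N → begin
          form H x x                  ≈⟨ cancel _ 0<N ⟨
          form H x x ÷ ∥ x ∥² * ∥ x ∥²  ≈⟨ *-comm _ _ ⟩
          ∥ x ∥² * (form H x x ÷ ∥ x ∥²) ≤⟨ *-monoˡ-≤ (inj₁ 0<N) (upper (ratio x 0<N)) ⟩
          ∥ x ∥² * μ                   ≈⟨ *-comm _ μ ⟩
          μ * ∥ x ∥²                   ∎)
        , (λ 0≈N → ≤-trans (form≤0 H x (sym 0≈N))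
                           (inj₂ (sym (trans (*-congˡ (sym 0≈N)) (zeroʳ μ))))) ]′
        (∥∥²-nonneg x)

  -- The matrix μI - H is semidefinite because μ is an upper bound. Were it uniformly positive with
  -- constants E and C, then μ - E/C would still be an upper bound, against leastness. So it has a
  -- null vector, which lies in its kernel and is an eigenvector of H for μ.
  maximal-ratio-eigenvector : ∀ {n} {H : Matrix n} → Symmetric H → ∀ {μ} →
                              IsMaximalRatio H μ → ∃[ v ] IsEigenvector H μ v
  maximal-ratio-eigenvector {n} {H} H-sym {μ} (upper , least) =
    [ from-null , (λ uniform → ⊥-elim (not-uniform uniform)) ]′
        (semidefinite-dichotomy gap-sym gap≥0)
    where
    gap : Matrix n
    gap i = combine μ (δ i) (- 1#) (H i)

    gap-sym : Symmetric gap
    gap-sym i j = +-cong (*-congˡ (δ-sym i j)) (*-congˡ (H-sym i j))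

    form-gap : ∀ x → form gap x x ≈ μ * ∥ x ∥² - form H x x
    form-gap x = trans (form-combine μ δ (- 1#) H x x)
      (+-cong (*-congˡ (dot-cong {x = x} (λ _ → refl) (λ i → dot-δˡ i x)))
              (solve 1 (λ q → (:- κ 1) :* q := :- q) refl (form H x x)))

    gap≥0 : PositiveSemidefinite gap
    gap≥0 x = ≤-trans (x≤y⇒0≤y-x (upper x)) (inj₂ (sym (form-gap x)))

    not-uniform : ¬ UniformlyPositive gap
    not-uniform (E , C , 0<E , 0<C , bound) = ≤-<-absurd (least (μ - t) smaller)
      (<-by t (*-pos 0<E (⁻¹-pos 0<C)) (solve 2 (λ μ t → μ := μ :- t :+ t) refl μ t))
      where
      t = E ÷ C
      Ct≈E : C * t ≈ E
      Ct≈E = trans (solve 3 (λ c e i → c :* (e :* i) := e :* (c :* i)) refl C E (C ⁻¹))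
                   (trans (*-congˡ (*-inverseʳ C (>⇒≉ 0<C))) (*-identityʳ E))
      smaller : ∀ x → form H x x ≤ (μ - t) * ∥ x ∥²
      smaller x = *-cancelˡ-≤ 0<C (≤-by (C * (μ * N - q) - C * t * N)
        (x≤y⇒0≤y-x (begin
          C * t * N        ≈⟨ *-congʳ Ct≈E ⟩
          E * N            ≤⟨ bound x ⟩
          C * form gap x x ≈⟨ *-congˡ (form-gap x) ⟩
          C * (μ * N - q)  ∎))
        (solve 5 (λ c q μ n t → c :* ((μ :- t) :* n) :=
           c :* q :+ (c :* (μ :* n :- q) :- c :* t :* n)) refl C q μ N t))
        where
        N = ∥ x ∥²
        q = form H x x

    from-null : NullVector gap → ∃[ v ] IsEigenvector H μ v
    from-null (v , v≉0 , null) = v , v≉0 , λ i → sym (begin-equality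
      μ * v i
        ≈⟨ solve 2 (λ p q → p := (p :+ (:- κ 1) :* q) :+ q) refl (μ * v i) (mul H v i) ⟩
      (μ * v i + - 1# * mul H v i) + mul H v i
        ≈⟨ +-congʳ (+-congʳ (*-congˡ (dot-δˡ i v))) ⟨
      (μ * mul δ v i + - 1# * mul H v i) + mul H v i
        ≈⟨ +-congʳ (mul-combine μ δ (- 1#) H v i) ⟨
      mul gap v i + mul H v i
        ≈⟨ +-congʳ (null⇒kernel {M = gap} gap-sym gap≥0 v null i) ⟩
      0# + mul H v i
        ≈⟨ +-identityˡ _ ⟩
      mul H v i ∎)

  top-eigenvector : ∀ {n} {H : Matrix n} → Symmetric H → ∀ y → 0# < form H y y →
                    ∃[ μ ] ∃[ v ] (0# < μ × IsEigenvector H μ v)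
  top-eigenvector {H = H} H-sym y 0<qy =
    let μ , 0<μ , maximal = maximal-ratio H y 0<qy
        v , v-eigen = maximal-ratio-eigenvector {H = H} H-sym maximal
    in μ , v , 0<μ , v-eigen

  orthogonal⇒independent : ∀ {n} {u v : Fin n → Carrier} → (∃[ i ] ¬ (u i ≈ 0#)) →
    (∃[ i ] ¬ (v i ≈ 0#)) → dot u v ≈ 0# → LinearlyIndependent u v
  orthogonal⇒independent {u = u} {v} (i , ui≉0) (j , vj≉0) u⊥v a b au+bv≈0 =
    *-cancelˡ-0 (∥∥²-pos u i ui≉0) (begin-equality
      ∥ u ∥² * a                 ≈⟨ *-comm _ a ⟩
      a * ∥ u ∥²                 ≈⟨ +-identityʳ _ ⟨
      a * ∥ u ∥² + 0#            ≈⟨ +-congˡ (trans (*-congˡ u⊥v) (zeroʳ b)) ⟨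
      a * ∥ u ∥² + b * dot u v   ≈⟨ vanish u ⟩
      0#                         ∎) ,
    *-cancelˡ-0 (∥∥²-pos v j vj≉0) (begin-equality
      ∥ v ∥² * b                 ≈⟨ *-comm _ b ⟩
      b * ∥ v ∥²                 ≈⟨ +-identityˡ _ ⟨
      0# + b * ∥ v ∥²            ≈⟨ +-congʳ (trans (*-congˡ (trans (dot-comm v u) u⊥v)) (zeroʳ a)) ⟨
      a * dot v u + b * ∥ v ∥²   ≈⟨ vanish v ⟩
      0#                         ∎)
    where
    vanish : ∀ z → a * dot z u + b * dot z v ≈ 0#
    vanish z = trans (sym (dot-linearʳ z a u b v))
      (trans (dot-cong {x = z} (λ _ → refl) au+bv≈0)
             (trans (dot-comm z _) (dot-zeroˡ z)))

  -- After deflating the top eigenvector u, the form is unchanged on the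
  -- orthogonal complement of u, so a second eigenvector is found there.
  positive-on-complement : ∀ {n} {H : Matrix n} → Symmetric H → AtMostOnePositiveEigenvalue H →
    ∀ {λ′ u} → 0# < λ′ → IsEigenvector H λ′ u → ∀ z → dot u z ≈ 0# → ¬ (0# < form H z z)
  positive-on-complement {H = H} H-sym one {λ′} {u} 0<λ u-eigen@((i , ui≉0) , Hu≈λu) z u⊥z 0<qz =
    contradict (top-eigenvector {H = deflated} deflated-sym z 0<qz′)
    where
    0<uu : 0# < ∥ u ∥²
    0<uu = ∥∥²-pos u i ui≉0
    k = - (λ′ * ∥ u ∥² ⁻¹)
    k-uu : k * ∥ u ∥² ≈ - λ′
    k-uu = trans (solve 3 (λ l i n → (:- (l :* i)) :* n := :- (l :* (n :* i))) refl λ′ _ _)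
      (-‿cong (trans (*-congˡ (*-inverseʳ _ (>⇒≉ 0<uu))) (*-identityʳ λ′)))
    deflated : Matrix _
    deflated i = combine 1# (H i) k (outer u u i)
    deflated-sym : Symmetric deflated
    deflated-sym i j = +-cong (*-congˡ (H-sym i j)) (*-congˡ (*-comm _ _))
    mul-deflated : ∀ x i → mul deflated x i ≈ mul H x i + k * (dot u x * u i)
    mul-deflated x i = trans (mul-combine 1# H k (outer u u) x i)
      (+-cong (*-identityˡ _) (*-congˡ (mul-outer u u x i)))
    0<qz′ : 0# < form deflated z z
    0<qz′ = <-respʳ-≈ (sym (trans (form-combine 1# H k (outer u u) z z)
      (trans (+-cong (*-identityˡ _) (trans (*-congˡ (trans (form-outer u u z z)
                (trans (*-congˡ u⊥z) (zeroʳ _)))) (zeroʳ k)))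
             (+-identityʳ _)))) 0<qz
    contradict : ∃[ μ ] ∃[ v ] (0# < μ × IsEigenvector deflated μ v) → ⊥
    contradict (μ , v , 0<μ , v≉0 , Dv≈μv) =
      one {λ′} {μ} {u} {v} u-eigen (v≉0 , Hv≈μv) 0<λ 0<μ
          (orthogonal⇒independent (i , ui≉0) v≉0 u⊥v)
      where
      -- Deflation is symmetric and sends u to 0, so an eigenvector for μ > 0 is orthogonal to u; on
      -- that complement the deflated matrix agrees with `H`.
      u⊥v : dot u v ≈ 0#
      u⊥v = *-cancelˡ-0 0<μ (begin-equality
        μ * dot u v
          ≈⟨ dot-scaleʳ u μ v ⟨
        dot u (λ i → μ * v i)
          ≈⟨ dot-cong {x = u} (λ _ → refl) Dv≈μv ⟨
        form deflated u v
          ≈⟨ form-comm {H = deflated} deflated-sym u v ⟩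
        form deflated v u
          ≈⟨ dot-cong {x = v} (λ _ → refl) (λ i → begin-equality
               mul deflated u i
                 ≈⟨ mul-deflated u i ⟩
               mul H u i + k * (∥ u ∥² * u i)
                 ≈⟨ +-cong (Hu≈λu i) (sym (*-assoc k _ _)) ⟩
               λ′ * u i + k * ∥ u ∥² * u i
                 ≈⟨ +-congˡ (*-congʳ k-uu) ⟩
               λ′ * u i + - λ′ * u i
                 ≈⟨ solve 2 (λ l x → l :* x :+ (:- l) :* x := κ 0) refl λ′ (u i) ⟩
               0# ∎) ⟩
        dot v (λ _ → 0#)
          ≈⟨ trans (dot-comm v _) (dot-zeroˡ v) ⟩
        0# ∎)
      Hv≈μv : ∀ i → mul H v i ≈ μ * v i
      Hv≈μv i = trans (sym (trans (mul-deflated v i)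
        (trans (+-congˡ (trans (*-congˡ (trans (*-congʳ u⊥v) (zeroˡ _))) (zeroʳ k)))
               (+-identityʳ _)))) (Dv≈μv i)

  -- With u an eigenvector for a positive eigenvalue, r = u·x and s = u·y, the vector z = sx - ry is
  -- orthogonal to u, and p·form H z z = r²(pq - b²) + (sp - rb)². If b² < pq this is positive for r
  -- ≠ 0, and for r = 0 the vector x itself is orthogonal to u. Either way the form is positive
  -- somewhere on the complement of u.
  reverse-Cauchy-Schwarz : ∀ {n} {H : Matrix n} → Symmetric H → AtMostOnePositiveEigenvalue H →
    ∀ x y → 0# < form H x x → form H x x * form H y y ≤ form H x y * form H x y
  reverse-Cauchy-Schwarz {H = H} H-sym one x y 0<p =
    ≮⇒≥ λ bb<pq → contradict bb<pq (top-eigenvector {H = H} H-sym x 0<p)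
    where
    p = form H x x
    q = form H y y
    b = form H x y
    contradict : b * b < p * q → ∃[ μ ] ∃[ v ] (0# < μ × IsEigenvector H μ v) → ⊥
    -- Comparing the square of r with 0 puts both signs of r into one case.
    contradict bb<pq (λ′ , u , 0<λ , u-eigen) with compare (dot u x * dot u x) 0#
    ... | tri< rr<0 _ _ = ≤-<-absurd (square-nonneg (dot u x)) rr<0
    ... | tri≈ _ rr≈0 _ = positive-on-complement {H = H} H-sym one 0<λ u-eigen x (square≈0 rr≈0) 0<p
    ... | tri> _ _ 0<rr = positive-on-complement {H = H} H-sym one 0<λ u-eigen z u⊥z
          (*-cancelˡ-< 0<p (<-respˡ-≈ (sym (zeroʳ p)) 0<pz))
      where
      r = dot u x
      s = dot u y
      z = combine s x (- r) y
      u⊥z : dot u z ≈ 0#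
      u⊥z = trans (dot-linearʳ u s x (- r) y)
                  (solve 2 (λ r s → s :* r :+ (:- r) :* s := κ 0) refl r s)
      0<pz : 0# < p * form H z z
      0<pz = <-respʳ-≈ (begin-equality
        r * r * (p * q - b * b) + (s * p - r * b) * (s * p - r * b)
          ≈⟨ solve 5 (λ p q b r s →
               r :* r :* (p :* q :- b :* b) :+ (s :* p :- r :* b) :* (s :* p :- r :* b) :=
               p :* (s :* s :* p :+ κ 2 :* (s :* (:- r)) :* b :+ (:- r) :* (:- r) :* q))
               refl p q b r s ⟩
        p * (s * s * p + 2# * (s * (- r)) * b + (- r) * (- r) * q)
          ≈⟨ *-congˡ (form-square {H = H} H-sym s x (- r) y) ⟨
        p * form H z z ∎)
        (pos-+ (*-pos 0<rr (x<y⇒0<y-x bb<pq)) (square-nonneg _))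

-- A hyperplane criterion for one positive eigenvalue, and inequalities between entries.

module Entries {c ℓ : Level} (ℝ : RealNumbers c ℓ) where

  open Lorentzian ℝ hiding (zero)
  open OrderedField ℝ
  open QuadraticForms ℝ
  open Hodge ℝ

  form-eigenvector : ∀ {n} (H : Matrix n) {λ′ u} → IsEigenvector H λ′ u → ∀ x →
                     form H x u ≈ λ′ * dot x u
  form-eigenvector H {λ′} {u} (_ , Hu≈λu) x =
    trans (dot-cong {x = x} (λ _ → refl) Hu≈λu) (dot-scaleʳ x λ′ u)

  eigenvectors-orthogonal : ∀ {n} {H : Matrix n} → Symmetric H → ∀ {λ′ μ u v} →
    IsEigenvector H λ′ u → IsEigenvector H μ v → μ < λ′ → dot u v ≈ 0#
  eigenvectors-orthogonal {H = H} H-sym {λ′} {μ} {u} {v} u-eigen v-eigen μ<λ =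
    *-cancelˡ-0 (x<y⇒0<y-x μ<λ) (begin-equality
      (λ′ - μ) * dot u v
        ≈⟨ solve 3 (λ l m d → (l :- m) :* d := l :* d :- m :* d) refl λ′ μ (dot u v) ⟩
      λ′ * dot u v - μ * dot u v
        ≈⟨ +-cong (*-congˡ (dot-comm u v)) (-‿cong (sym (form-eigenvector H v-eigen u))) ⟩
      λ′ * dot v u - form H u v
        ≈⟨ +-cong (sym (form-eigenvector H u-eigen v)) (-‿cong (form-comm {H = H} H-sym u v)) ⟩
      form H v u - form H v u
        ≈⟨ -‿inverseʳ _ ⟩
      0# ∎)

  -- The span of two independent eigenvectors meets the hyperplane: in u if r = φ·u vanishes,
  -- otherwise in z = su - rv. For different eigenvalues u and v are orthogonal, so the form at z is
  -- a sum of a positive and a nonnegative term; for equal ones z is itself an eigenvector, nonzero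
  -- by independence.
  nonpositive-on-hyperplane : ∀ {n} {H : Matrix n} → Symmetric H → ∀ φ →
    (∀ x → dot φ x ≈ 0# → form H x x ≤ 0#) → AtMostOnePositiveEigenvalue H
  nonpositive-on-hyperplane {n} {H} H-sym φ H≤0 {λ′} {μ} {u} {v}
                            u-eigen@((i , ui≉0) , Hu) v-eigen@((j , vj≉0) , Hv) 0<λ 0<μ indep =
    by-cases (compare (r * r) 0#) (compare λ′ μ)
    where
    r = dot φ u
    s = dot φ v
    z = combine s u (- r) v
    φz≈0 : dot φ z ≈ 0#
    φz≈0 = trans (dot-linearʳ φ s u (- r) v)
                 (solve 2 (λ r s → s :* r :+ (:- r) :* s := κ 0) refl r s)
    form-u : 0# < form H u u
    form-u = <-respʳ-≈ (sym (form-eigenvector H u-eigen u)) (*-pos 0<λ (∥∥²-pos u i ui≉0))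
    form-z : dot u v ≈ 0# → 0# < r * r → 0# < form H z z
    form-z u⊥v 0<rr = <-respʳ-≈ (begin-equality
      r * r * (μ * ∥ v ∥²) + s * s * (λ′ * ∥ u ∥²)
        ≈⟨ solve 4 (λ r s p q → r :* r :* q :+ s :* s :* p :=
             s :* s :* p :+ κ 2 :* (s :* (:- r)) :* κ 0 :+ (:- r) :* (:- r) :* q) refl r s _ _ ⟩
      s * s * (λ′ * ∥ u ∥²) + 2# * (s * (- r)) * 0# + (- r) * (- r) * (μ * ∥ v ∥²)
        ≈⟨ +-cong (+-cong (*-congˡ (form-eigenvector H u-eigen u))
                    (*-congˡ (trans (form-eigenvector H v-eigen u) (trans (*-congˡ u⊥v) (zeroʳ μ)))))
                  (*-congˡ (form-eigenvector H v-eigen v)) ⟨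
      s * s * form H u u + 2# * (s * (- r)) * form H u v + (- r) * (- r) * form H v v
        ≈⟨ form-square {H = H} H-sym s u (- r) v ⟨
      form H z z ∎)
      (pos-+ (*-pos 0<rr (*-pos 0<μ (∥∥²-pos v j vj≉0)))
             (nonneg-* (square-nonneg s) (nonneg-* (inj₁ 0<λ) (∥∥²-nonneg u))))
    Hz≈λz : λ′ ≈ μ → form H z z ≈ λ′ * ∥ z ∥²
    Hz≈λz λ≈μ = trans (form-linearʳ H z s u (- r) v) (begin-equality
      s * form H z u + - r * form H z v
        ≈⟨ +-cong (*-congˡ (form-eigenvector H u-eigen z)) (*-congˡ
             (trans (form-eigenvector H v-eigen z) (*-congʳ (sym λ≈μ)))) ⟩
      s * (λ′ * dot z u) + - r * (λ′ * dot z v)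
        ≈⟨ solve 5 (λ s r l p q → s :* (l :* p) :+ (:- r) :* (l :* q) :=
             l :* (s :* p :+ (:- r) :* q)) refl s r λ′ _ _ ⟩
      λ′ * (s * dot z u + - r * dot z v)
        ≈⟨ *-congˡ (dot-linearʳ z s u (- r) v) ⟨
      λ′ * ∥ z ∥² ∎)
    z≉0 : 0# < r * r → 0# < ∥ z ∥²
    z≉0 0<rr = [ (λ 0<N → 0<N) , (λ 0≈N → ⊥-elim (>⇒≉ 0<rr (begin-equality
        r * r         ≈⟨ solve 1 (λ r → r :* r := (:- r) :* (:- r)) refl r ⟩
        (- r) * (- r) ≈⟨ *-congʳ (proj₂ (indep s (- r) (∥∥²≈0 z (sym 0≈N)))) ⟩
        0# * (- r)    ≈⟨ zeroˡ _ ⟩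
        0#            ∎))) ]′ (∥∥²-nonneg z)
    by-cases : _ → _ → ⊥
    by-cases (tri< rr<0 _ _) _ = ≤-<-absurd (square-nonneg r) rr<0
    by-cases (tri≈ _ rr≈0 _) _ = ≤-<-absurd (H≤0 u (square≈0 rr≈0)) form-u
    by-cases (tri> _ _ 0<rr) (tri< λ<μ _ _) = ≤-<-absurd (H≤0 z φz≈0)
      (form-z (trans (dot-comm u v) (eigenvectors-orthogonal H-sym v-eigen u-eigen λ<μ)) 0<rr)
    by-cases (tri> _ _ 0<rr) (tri≈ _ λ≈μ _) = ≤-<-absurd (H≤0 z φz≈0)
      (<-respʳ-≈ (sym (Hz≈λz λ≈μ)) (*-pos 0<λ (z≉0 0<rr)))
    by-cases (tri> _ _ 0<rr) (tri> _ _ μ<λ) = ≤-<-absurd (H≤0 z φz≈0)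
      (form-z (eigenvectors-orthogonal H-sym u-eigen v-eigen μ<λ) 0<rr)

  form-δδ : ∀ {n} (H : Matrix n) a i b j c k d l →
            form H (combine a (δ i) b (δ j)) (combine c (δ k) d (δ l)) ≈
            a * (c * H i k + d * H i l) + b * (c * H j k + d * H j l)
  form-δδ H a i b j c k d l = trans (form-linearˡ H _ a (δ i) b (δ j))
    (+-cong (*-congˡ (row i)) (*-congˡ (row j)))
    where
    row : ∀ i → form H (δ i) (combine c (δ k) d (δ l)) ≈ c * H i k + d * H i l
    row i = trans (form-linearʳ H (δ i) c (δ k) d (δ l))
                  (+-cong (*-congˡ (form-δ H i k)) (*-congˡ (form-δ H i l)))

  module _ {n} {H : Matrix n} (H-sym : Symmetric H) (one : AtMostOnePositiveEigenvalue H)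
           (H>0 : ∀ i j → 0# < H i j) where

    form-δδ-bound : ∀ a i b j → form H (combine a (δ i) b (δ j)) (combine a (δ i) b (δ j)) ≈
                    2# * (a * b) * H i j + (a * a * H i i + b * b * H j j)
    form-δδ-bound a i b j = trans (form-δδ H a i b j a i b j)
      (trans (+-congˡ (*-congˡ (+-congʳ (*-congˡ (H-sym j i)))))
        (solve 5 (λ a b p q r → a :* (a :* p :+ b :* q) :+ b :* (a :* q :+ b :* r) :=
           κ 2 :* (a :* b) :* q :+ (a :* a :* p :+ b :* b :* r)) refl a b _ _ _))

    diagonal-nonneg : ∀ a i b j → 0# ≤ a * a * H i i + b * b * H j j
    diagonal-nonneg a i b j = nonneg-+ (nonneg-* (square-nonneg a) (inj₁ (H>0 i i)))
                                       (nonneg-* (square-nonneg b) (inj₁ (H>0 j j)))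

    -- The reverse Cauchy–Schwarz inequality for x = a eᵢ + b eⱼ and
    -- y = c eₖ + d eₗ with positive coefficients, dropping diagonal entries.
    two-pair-bound : ∀ a i b j c k d l → 0# < a * b → 0# ≤ c * d →
      let t = a * (c * H i k + d * H i l) + b * (c * H j k + d * H j l) in
      (2# * (a * b) * H i j) * (2# * (c * d) * H k l) ≤ t * t
    two-pair-bound a i b j c k d l 0<ab 0≤cd = begin
      (2# * (a * b) * H i j) * (2# * (c * d) * H k l)
        ≤⟨ *-mono-≤ (inj₁ 0<x) (nonneg-+ 0≤y (diagonal-nonneg c k d l))
                    (≤-by _ (diagonal-nonneg a i b j) refl) (≤-by _ (diagonal-nonneg c k d l) refl) ⟩
      (2# * (a * b) * H i j + (a * a * H i i + b * b * H j j)) *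
      (2# * (c * d) * H k l + (c * c * H k k + d * d * H l l))
        ≈⟨ *-cong (form-δδ-bound a i b j) (form-δδ-bound c k d l) ⟨
      form H x x * form H y y
        ≤⟨ reverse-Cauchy-Schwarz {H = H} H-sym one x y
             (<-respʳ-≈ (sym (form-δδ-bound a i b j)) (pos-+ 0<x (diagonal-nonneg a i b j))) ⟩
      form H x y * form H x y
        ≈⟨ *-cong (form-δδ H a i b j c k d l) (form-δδ H a i b j c k d l) ⟩
      (a * (c * H i k + d * H i l) + b * (c * H j k + d * H j l)) *
      (a * (c * H i k + d * H i l) + b * (c * H j k + d * H j l)) ∎
      where
      x = combine a (δ i) b (δ j)
      y = combine c (δ k) d (δ l)
      0<x : 0# < 2# * (a * b) * H i j
      0<x = *-pos (*-pos 0<2 0<ab) (H>0 i j)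
      0≤y : 0# ≤ 2# * (c * d) * H k l
      0≤y = nonneg-* (nonneg-* (inj₁ 0<2) 0≤cd) (inj₁ (H>0 k l))

    -- The test vectors are eᵢ and y = Hᵢₖeⱼ + Hᵢⱼeₖ. The weights make both terms of eᵢᵀHy equal to
    -- HᵢⱼHᵢₖ, and yᵀHy is at least its mixed term.
    diagonal-entry-bound : ∀ i j k → H i i * H j k ≤ 2# * (H i j * H i k)
    diagonal-entry-bound i j k = *-cancelˡ-≤ (*-pos 0<2 0<rs) (begin
      2# * (r * s) * (H i i * H j k)
        ≈⟨ solve 3 (λ t p q → t :* (p :* q) := p :* (t :* q)) refl (2# * (r * s)) _ _ ⟩
      H i i * (2# * (r * s) * H j k)
        ≤⟨ *-monoˡ-≤ (inj₁ (H>0 i i)) (≤-by _ (diagonal-nonneg r j s k) refl) ⟩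
      H i i * (2# * (r * s) * H j k + (r * r * H j j + s * s * H k k))
        ≈⟨ *-cong (form-δ H i i) (form-δδ-bound r j s k) ⟨
      form H (δ i) (δ i) * form H y y
        ≤⟨ reverse-Cauchy-Schwarz {H = H} H-sym one (δ i) y
             (<-respʳ-≈ (sym (form-δ H i i)) (H>0 i i)) ⟩
      form H (δ i) y * form H (δ i) y
        ≈⟨ *-cong row row ⟩
      (r * s + s * r) * (r * s + s * r)
        ≈⟨ solve 2 (λ r s → (r :* s :+ s :* r) :* (r :* s :+ s :* r) :=
             κ 2 :* (r :* s) :* (κ 2 :* (s :* r))) refl r s ⟩
      2# * (r * s) * (2# * (s * r)) ∎)
      where
      r = H i k
      s = H i j
      y = combine r (δ j) s (δ k)
      0<rs : 0# < r * s
      0<rs = *-pos (H>0 i k) (H>0 i j)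
      row : form H (δ i) y ≈ r * s + s * r
      row = trans (form-linearʳ H (δ i) r (δ j) s (δ k))
                  (+-cong (*-congˡ (form-δ H i j)) (*-congˡ (form-δ H i k)))

    -- With s = Hⱼₗ, r = Hᵢₖ and q = Hᵢₗ the test vectors are seᵢ + qeⱼ and qeₖ + reₗ. The weights
    -- make three of the four terms of the mixed product equal to qrs, and the hypothesis bounds the
    -- fourth, q²Hⱼₖ, by the same qrs. The mixed product is therefore at most 4qrs, whence the
    -- factor 4 after cancellation.
    three-term-bound : ∀ i j k l → H i l * H j k ≤ H i k * H j l →
                       H i j * H k l ≤ 2# * 2# * (H i k * H j l)
    three-term-bound i j k l z≤y = *-cancelˡ-≤ (*-pos (*-pos 0<2 0<2) (*-pos 0<y 0<qq)) (begin
      2# * 2# * (y * (q * q)) * (H i j * H k l)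
        ≈⟨ solve 5 (λ s r q p w → κ 2 :* κ 2 :* ((r :* s) :* (q :* q)) :* (p :* w) :=
             (κ 2 :* (s :* q) :* p) :* (κ 2 :* (q :* r) :* w)) refl s r q (H i j) (H k l) ⟩
      (2# * (s * q) * H i j) * (2# * (q * r) * H k l)
        ≤⟨ two-pair-bound s i q j q k r l (*-pos (H>0 j l) (H>0 i l))
                                          (inj₁ (*-pos (H>0 i l) (H>0 i k))) ⟩
      _ ≈⟨ solve 4 (λ s r q w → let t = s :* (q :* r :+ r :* q) :+ q :* (q :* w :+ r :* s)
                                    u = q :* (κ 3 :* (r :* s) :+ q :* w) in
             t :* t := u :* u) refl s r q (H j k) ⟩
      (q * (3# * y + q * H j k)) * (q * (3# * y + q * H j k))
        ≤⟨ *-mono-≤ 0≤m 0≤M m≤M m≤M ⟩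
      (q * (3# * y + y)) * (q * (3# * y + y))
        ≈⟨ solve 2 (λ y q → let v = q :* (κ 3 :* y :+ y) in v :* v :=
             κ 2 :* κ 2 :* (y :* (q :* q)) :* (κ 2 :* κ 2 :* y)) refl y q ⟩
      2# * 2# * (y * (q * q)) * (2# * 2# * y) ∎)
      where
      s = H j l
      r = H i k
      q = H i l
      y = r * s
      3# = 2# + 1#
      0<3 : 0# < 3#
      0<3 = pos-+ 0<2 0≤1
      0<y : 0# < y
      0<y = *-pos (H>0 i k) (H>0 j l)
      0<qq : 0# < q * q
      0<qq = *-pos (H>0 i l) (H>0 i l)
      m≤M : q * (3# * y + q * H j k) ≤ q * (3# * y + y)
      m≤M = *-monoˡ-≤ (inj₁ (H>0 i l)) (+-mono-≤ (inj₂ refl) z≤y)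
      0≤m : 0# ≤ q * (3# * y + q * H j k)
      0≤m = nonneg-* (inj₁ (H>0 i l)) (nonneg-+ (nonneg-* (inj₁ 0<3) (inj₁ 0<y))
              (inj₁ (*-pos (H>0 i l) (H>0 j k))))
      0≤M : 0# ≤ q * (3# * y + y)
      0≤M = ≤-trans 0≤m m≤M

-- The bound 32 for cubics in five variables.

Δ-≡ : ∀ {n d} {α β : Δ n d} → value α ≡ value β → α ≡ β
Δ-≡ {α = _ ⊣ _} {_ ⊣ _} ≡.refl = ≡.refl

zipWith-+-swap : ∀ {n} (u v w : Vec ℕ n) →
  zipWith ℕ._+_ u (zipWith ℕ._+_ v w) ≡ zipWith ℕ._+_ v (zipWith ℕ._+_ u w)
zipWith-+-swap u v w = ≡.trans (≡.sym (Vecₚ.zipWith-assoc ℕₚ.+-assoc u v w))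
  (≡.trans (≡.cong (λ x → zipWith ℕ._+_ x w) (Vecₚ.zipWith-comm ℕₚ.+-comm u v))
           (Vecₚ.zipWith-assoc ℕₚ.+-assoc v u w))

e-swap : ∀ {n d} (i j : Fin n) (β : Δ n d) → e i ⊕ e j ⊕ β ≡ e j ⊕ e i ⊕ β
e-swap i j β = Δ-≡ (zipWith-+-swap (unit i) (unit j) (value β))

module Cubic {c ℓ : Level} (ℝ : RealNumbers c ℓ) where

  open Lorentzian ℝ hiding (zero)
  open OrderedField ℝ
  open QuadraticForms ℝ using (Symmetric)
  open Entries ℝ
  private
    module Monomial = MonoidSolver *-commutativeMonoid
  open Monomial using (_⊜_) renaming (_⊕_ to _⊛_; id to one)

  hessian-symmetric : ∀ {n k} (f : Polynomial n (2 ℕ.+ k)) β → Symmetric (hessian f β)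
  hessian-symmetric f β i j = reflexive (≡.cong f (e-swap i j β))

  coefficient-pos : ∀ {n k} {f : Polynomial n (2 ℕ.+ k)} → f ∈ 𝓛⁺ full → ∀ α → 0# < f α
  coefficient-pos (_ , f>0) α = Equivalence.from (f>0 α) tt

  *-mono₄-≤ : ∀ {p₁ p₂ p₃ p₄ q₁ q₂ q₃ q₄} →
    0# < p₁ → 0# < p₂ → 0# < p₃ → 0# < p₄ →
    p₁ ≤ q₁ → p₂ ≤ q₂ → p₃ ≤ q₃ → p₄ ≤ q₄ →
    p₁ * (p₂ * (p₃ * p₄)) ≤ q₁ * (q₂ * (q₃ * q₄))
  *-mono₄-≤ a b c d p q r s =
    step a (*-pos b (*-pos c d)) p (step b (*-pos c d) q (step c d r s))
    where
    step : ∀ {w x y z} → 0# < w → 0# < y → w ≤ x → y ≤ z → w * y ≤ x * z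
    step a b p q = *-mono-≤ (inj₁ a) (≤-trans (inj₁ b) q) p q

  fromℕ-32 : fromℕ 32 ≈ 2# * 2# * (2# * (2# * 2#))
  fromℕ-32 = begin-equality
    fromℕ 32                   ≈⟨ ×1-homo-* 4 8 ⟩
    fromℕ 4 * fromℕ 8          ≈⟨ *-cong (×1-homo-* 2 2) (×1-homo-* 2 4) ⟩
    fromℕ 2 * fromℕ 2 * (fromℕ 2 * fromℕ 4)
                               ≈⟨ *-congˡ (*-congˡ (×1-homo-* 2 2)) ⟩
    fromℕ 2 * fromℕ 2 * (fromℕ 2 * (fromℕ 2 * fromℕ 2))
                               ≈⟨ *-cong (*-cong two two) (*-cong two (*-cong two two)) ⟩
    2# * 2# * (2# * (2# * 2#)) ∎
    where
    two : fromℕ 2 ≈ 2#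
    two = +-congˡ (+-identityʳ 1#)

  module _ {f : Polynomial 5 3} (f∈𝓛 : f ∈ 𝓛⁺ {5} {1} full) where

    private
      H : Fin 5 → Matrix 5
      H p = hessian f (e p)

      H>0 : ∀ p i j → 0# < H p i j
      H>0 p i j = coefficient-pos {f = f} f∈𝓛 (e i ⊕ e j ⊕ e p)

      diagonal : ∀ p i j k → H p i i * H p j k ≤ 2# * (H p i j * H p i k)
      diagonal p = diagonal-entry-bound (hessian-symmetric f (e p))
        (IsLorentzian.hess (proj₁ f∈𝓛) (e p)) (H>0 p)

      three-term : ∀ p i j k l → H p i l * H p j k ≤ H p i k * H p j l →
                   H p i j * H p k l ≤ 2# * 2# * (H p i k * H p j l)
      three-term p = three-term-bound (hessian-symmetric f (e p))
        (IsLorentzian.hess (proj₁ f∈𝓛) (e p)) (H>0 p)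

      -- For concrete indices the multi-index evaluates and its degree proof is irrelevant. All
      -- orders of the three indices thus give definitionally equal terms, which are also the
      -- factors of `N` and `D`; `abc` stands equally for `H ic ia ib`.
      aaa = H ia ia ia
      aab = H ia ia ib
      aac = H ia ia ic
      aad = H ia ia id
      aae = H ia ia ie
      abc = H ia ib ic
      abd = H ia ib id
      acd = H ia ic id
      ace = H ia ic ie
      ade = H ia id ie
      bcd = H ib ic id
      ccd = H ic ic id
      cdd = H ic id id
      cde = H ic id ie
      dde = H id id ie

      N = ∏[ numerator₅ ] f
      D = ∏[ denominator₅ ] f

    -- The companions are cdd·abc ≤ 2 acd·bcd in the link of c, ccd·dde ≤ 2 cdd·cde in the link of d
    -- and aaa·ace ≤ 2 aac·aae in the link of a. In the product of all four the factor acd·cdd·abc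
    -- occurs on both sides, and what remains is the claim.
    via-aad-abc : aac * abd ≤ aad * abc → N ≤ 2# * 2# * (2# * (2# * 2#)) * D
    via-aad-abc h = *-cancelˡ-≤ (*-pos (H>0 ia ic id) (*-pos (H>0 ic id id) (H>0 ia ib ic))) (begin
      acd * (cdd * abc) * (aaa * (aab * (ace * (ccd * (dde * 1#)))))
        ≈⟨ Monomial.solve 8 (λ aaa aab abc acd ace ccd cdd dde →
             (acd ⊛ (cdd ⊛ abc)) ⊛ (aaa ⊛ (aab ⊛ (ace ⊛ (ccd ⊛ (dde ⊛ one))))) ⊜
             (aab ⊛ acd) ⊛ ((cdd ⊛ abc) ⊛ ((ccd ⊛ dde) ⊛ (aaa ⊛ ace))))
             refl aaa aab abc acd ace ccd cdd dde ⟩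
      (aab * acd) * ((cdd * abc) * ((ccd * dde) * (aaa * ace)))
        ≤⟨ *-mono₄-≤ (*-pos (H>0 ia ia ib) (H>0 ia ic id)) (*-pos (H>0 ic id id) (H>0 ia ib ic))
             (*-pos (H>0 ic ic id) (H>0 id id ie)) (*-pos (H>0 ia ia ia) (H>0 ia ic ie))
             (three-term ia ia ib id ic h) (diagonal ic id ia ib)
             (diagonal id ic id ie) (diagonal ia ia ic ie) ⟩
      2# * 2# * (aad * abc) * (2# * (acd * bcd) * (2# * (cdd * cde) * (2# * (aac * aae))))
        ≈⟨ Monomial.solve 9 (λ t aac aad aae abc acd bcd cdd cde →
             ((t ⊛ t) ⊛ (aad ⊛ abc)) ⊛ ((t ⊛ (acd ⊛ bcd)) ⊛ ((t ⊛ (cdd ⊛ cde)) ⊛ (t ⊛ (aac ⊛ aae)))) ⊜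
             (acd ⊛ (cdd ⊛ abc)) ⊛ (((t ⊛ t) ⊛ (t ⊛ (t ⊛ t))) ⊛
               (aac ⊛ (aad ⊛ (aae ⊛ (bcd ⊛ (cde ⊛ one)))))))
             refl 2# aac aad aae abc acd bcd cdd cde ⟩
      acd * (cdd * abc) * (2# * 2# * (2# * (2# * 2#)) * (aac * (aad * (aae * (bcd * (cde * 1#)))))) ∎)

    -- The companions are dde·ace ≤ 2 ade·cde in the link of e, aaa·ade ≤ 2 aad·aae in the link of a
    -- and ccd·abd ≤ 2 acd·bcd in the link of d. Here the common factor is acd·ade·abd.
    via-aac-abd : aad * abc ≤ aac * abd → N ≤ 2# * 2# * (2# * (2# * 2#)) * D
    via-aac-abd h = *-cancelˡ-≤ (*-pos (H>0 ia ic id) (*-pos (H>0 ia id ie) (H>0 ia ib id))) (begin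
      acd * (ade * abd) * (aaa * (aab * (ace * (ccd * (dde * 1#)))))
        ≈⟨ Monomial.solve 8 (λ aaa aab abd acd ace ade ccd dde →
             (acd ⊛ (ade ⊛ abd)) ⊛ (aaa ⊛ (aab ⊛ (ace ⊛ (ccd ⊛ (dde ⊛ one))))) ⊜
             (aab ⊛ acd) ⊛ ((dde ⊛ ace) ⊛ ((aaa ⊛ ade) ⊛ (ccd ⊛ abd))))
             refl aaa aab abd acd ace ade ccd dde ⟩
      (aab * acd) * ((dde * ace) * ((aaa * ade) * (ccd * abd)))
        ≤⟨ *-mono₄-≤ (*-pos (H>0 ia ia ib) (H>0 ia ic id)) (*-pos (H>0 id id ie) (H>0 ia ic ie))
             (*-pos (H>0 ia ia ia) (H>0 ia id ie)) (*-pos (H>0 ic ic id) (H>0 ia ib id))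
             (three-term ia ia ib ic id h) (diagonal ie id ia ic)
             (diagonal ia ia id ie) (diagonal id ic ia ib) ⟩
      2# * 2# * (aac * abd) * (2# * (ade * cde) * (2# * (aad * aae) * (2# * (acd * bcd))))
        ≈⟨ Monomial.solve 9 (λ t aac aad aae abd acd ade bcd cde →
             ((t ⊛ t) ⊛ (aac ⊛ abd)) ⊛ ((t ⊛ (ade ⊛ cde)) ⊛ ((t ⊛ (aad ⊛ aae)) ⊛ (t ⊛ (acd ⊛ bcd)))) ⊜
             (acd ⊛ (ade ⊛ abd)) ⊛ (((t ⊛ t) ⊛ (t ⊛ (t ⊛ t))) ⊛
               (aac ⊛ (aad ⊛ (aae ⊛ (bcd ⊛ (cde ⊛ one)))))))
             refl 2# aac aad aae abd acd ade bcd cde ⟩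
      acd * (ade * abd) * (2# * 2# * (2# * (2# * 2#)) * (aac * (aad * (aae * (bcd * (cde * 1#)))))) ∎)

    numerator≤32denominator : N ≤ fromℕ 32 * D
    numerator≤32denominator = ≤-trans
      ([ via-aad-abc , via-aac-abd ]′ (≤-total (aac * abd) (aad * abc)))
      (inj₂ (*-congʳ (sym fromℕ-32)))

    denominator-pos : 0# < D
    denominator-pos = *-pos (H>0 ia ia ic) (*-pos (H>0 ia ia id) (*-pos (H>0 ia ia ie)
      (*-pos (H>0 ib ic id) (*-pos (H>0 ic id ie) 0<1))))

    R₅≤32 : R₅ f ≤ fromℕ 32
    R₅≤32 = begin
      N * D ⁻¹            ≈⟨ *-comm N _ ⟩
      D ⁻¹ * N            ≤⟨ *-monoˡ-≤ (inj₁ (⁻¹-pos denominator-pos)) numerator≤32denominator ⟩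
      D ⁻¹ * (fromℕ 32 * D) ≈⟨ trans (*-comm _ _) (*-assoc _ _ _) ⟩
      fromℕ 32 * (D * D ⁻¹) ≈⟨ trans (*-congˡ (*-inverseʳ D (>⇒≉ denominator-pos))) (*-identityʳ _) ⟩
      fromℕ 32            ∎

-- Exchange in the full simplex and enumeration of its elements.

decrement-unit : ∀ {n} (u : Vec ℕ n) i → 0 ℕ.< lookup u i →
                 zipWith ℕ._+_ (unit i) (updateAt u i ℕ.pred) ≡ u
decrement-unit (suc k ∷ u) zero    _   = ≡.cong (suc k ∷_) (Vecₚ.zipWith-identityˡ (λ _ → ≡.refl) u)
decrement-unit (k ∷ u)     (suc i) 0<u = ≡.cong (k ∷_) (decrement-unit u i 0<u)

transfer : ∀ {n d} (α : Δ n d) i j → 0 ℕ.< α at i → ∃[ α′ ] α′ ⊕ e i ≡ α ⊕ e j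
transfer {d = d} α@(u ⊣ [ p ]) i j 0<αi = (w ⊣ [ ≡.trans sum-w p ]) , Δ-≡ w+i≡u+j
  where
  w = zipWith ℕ._+_ (updateAt u i ℕ.pred) (unit j)
  w+i≡u+j : zipWith ℕ._+_ w (unit i) ≡ zipWith ℕ._+_ u (unit j)
  w+i≡u+j = ≡.trans (Vecₚ.zipWith-comm ℕₚ.+-comm w (unit i))
    (≡.trans (≡.sym (Vecₚ.zipWith-assoc ℕₚ.+-assoc (unit i) (updateAt u i ℕ.pred) (unit j)))
             (≡.cong (λ x → zipWith ℕ._+_ x (unit j)) (decrement-unit u i 0<αi)))
  sum-w : Vec.sum w ≡ Vec.sum u
  sum-w = ℕₚ.+-cancelʳ-≡ 1 _ _ (≡.trans (≡.cong (Vec.sum w ℕ.+_) (≡.sym (sum-unit i)))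
    (≡.trans (≡.sym (sum-zipWith-+ w (unit i)))
    (≡.trans (≡.cong Vec.sum w+i≡u+j)
    (≡.trans (sum-zipWith-+ u (unit j)) (≡.cong (Vec.sum u ℕ.+_) (sum-unit j))))))

sum-mono-≤ : ∀ {n} (u v : Vec ℕ n) → (∀ i → lookup u i ℕ.≤ lookup v i) → Vec.sum u ℕ.≤ Vec.sum v
sum-mono-≤ []      []      u≤v = ℕ.z≤n
sum-mono-≤ (x ∷ u) (y ∷ v) u≤v = ℕₚ.+-mono-≤ (u≤v zero) (sum-mono-≤ u v (u≤v ∘ suc))

sum-mono-< : ∀ {n} (u v : Vec ℕ n) → (∀ i → lookup u i ℕ.≤ lookup v i) →
             ∀ i → lookup u i ℕ.< lookup v i → Vec.sum u ℕ.< Vec.sum v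
sum-mono-< (x ∷ u) (y ∷ v) u≤v zero    u<v = ℕₚ.+-mono-<-≤ u<v (sum-mono-≤ u v (u≤v ∘ suc))
sum-mono-< (x ∷ u) (y ∷ v) u≤v (suc i) u<v = ℕₚ.+-mono-≤-< (u≤v zero) (sum-mono-< u v (u≤v ∘ suc) i u<v)

smaller-elsewhere : ∀ {n d} (α β : Δ n d) i → β at i ℕ.< α at i → ∃[ j ] α at j ℕ.< β at j
smaller-elsewhere {d = d} (u ⊣ [ p ]) (v ⊣ [ q ]) i v<u with Finₚ.any? (λ j → lookup u j ℕₚ.<? lookup v j)
... | yes found = found
... | no none   = ⊥-elim (ℕₚ.<-irrefl (recompute (_ ℕₚ.≟ _) (≡.trans q (≡.sym p)))
                    (sum-mono-< v u (λ j → ℕₚ.≮⇒≥ λ u<v → none (j , u<v)) i v<u))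

-- Every j with αⱼ < βⱼ serves in the exchange, and one exists because α and β have the same degree.
universal-M-convex : ∀ {n d a} {S : Pred (Δ n d) a} → Δ n d → (∀ α → S α) → IsMConvex S
universal-M-convex α₀ all = record
  { nonempty = α₀ , all α₀
  ; exchange = λ {α} {β} _ _ i β<α →
      let j , α<β  = smaller-elsewhere α β i β<α
          α′ , eqα = transfer α i j (ℕₚ.≤-<-trans ℕ.z≤n β<α)
          β′ , eqβ = transfer β j i (ℕₚ.≤-<-trans ℕ.z≤n α<β)
      in j , α<β , (α′ , all α′ , eqα) , (β′ , all β′ , eqβ)
  }

mapMaybe-total : ∀ {a b} {A : Set a} {B : Set b} {f : A → Maybe B} {g : A → B} →
                 (∀ x → f x ≡ just (g x)) → ∀ xs → mapMaybe f xs ≡ List.map g xs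
mapMaybe-total f≡just [] = ≡.refl
mapMaybe-total {g = g} f≡just (x ∷ xs) rewrite f≡just x =
  ≡.cong (g x ∷_) (mapMaybe-total f≡just xs)

member : ∀ {n d} → Δ n d → Elem (full {n} {d})
member α = α ⊣ [ tt ]

elements-full : ∀ n d → elements (full {n} {d}) ≡ List.map member (allΔ n d)
elements-full n d = mapMaybe-total (λ _ → ≡.refl) (allΔ n d)

sum≡0 : ∀ {n} (w : Vec ℕ n) → Vec.sum w ≡ 0 → w ≡ replicate n 0
sum≡0 []         _ = ≡.refl
sum≡0 (zero ∷ w) q = ≡.cong (0 ∷_) (sum≡0 w q)

-- For a quadratic polynomial the Hessian condition ranges over multi-indices of degree 0. Such a ζ
-- is the zero vector, but only propositionally.
⊕-degree-zero : ∀ {n d} i j (ζ : Δ n 0) (β : Δ n d) → (e i ⊕ e j ⊕ ζ) ⊕ β ≡ e i ⊕ e j ⊕ β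
⊕-degree-zero {n} i j (z ⊣ [ p ]) β = Δ-≡ (begin
  (unit i ⊞ (unit j ⊞ z)) ⊞ value β
    ≡⟨ Vecₚ.zipWith-assoc ℕₚ.+-assoc (unit i) (unit j ⊞ z) (value β) ⟩
  unit i ⊞ ((unit j ⊞ z) ⊞ value β)
    ≡⟨ ≡.cong (unit i ⊞_) (Vecₚ.zipWith-assoc ℕₚ.+-assoc (unit j) z (value β)) ⟩
  unit i ⊞ (unit j ⊞ (z ⊞ value β))
    ≡⟨ ≡.cong (λ w → unit i ⊞ (unit j ⊞ w)) (≡.trans
         (≡.cong (_⊞ value β) (sum≡0 z (recompute (_ ℕₚ.≟ _) p)))
         (Vecₚ.zipWith-identityˡ (λ _ → ≡.refl) (value β))) ⟩
  unit i ⊞ (unit j ⊞ value β) ∎)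
  where
  open ≡.≡-Reasoning
  _⊞_ : Vec ℕ n → Vec ℕ n → Vec ℕ n
  _⊞_ = zipWith ℕ._+_

-- Logarithms of ratios as a linear pairing.

module Pairing {c ℓ : Level} (ℝ : RealNumbers c ℓ) where

  open Lorentzian ℝ hiding (zero)
  open OrderedField ℝ

  exp-mono-≤ : ∀ {x y} → x ≤ y → exp x ≤ exp y
  exp-mono-≤ (inj₁ x<y) = inj₁ (exp-mono-< x<y)
  exp-mono-≤ (inj₂ x≈y) = inj₂ (exp-cong x≈y)

  exp-cancel-≤ : ∀ {x y} → exp x ≤ exp y → x ≤ y
  exp-cancel-≤ p = ≮⇒≥ λ y<x → ≤-<-absurd p (exp-mono-< y<x)

  exp-cancel-< : ∀ {x y} → exp x < exp y → x < y
  exp-cancel-< {x} {y} p with compare x y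
  ... | tri< x<y _ _ = x<y
  ... | tri≈ _ x≈y _ = ⊥-elim (irrefl (exp-cong x≈y) p)
  ... | tri> _ _ y<x = ⊥-elim (<-asym p (exp-mono-< y<x))

  exp-injective : ∀ {x y} → exp x ≈ exp y → x ≈ y
  exp-injective {x} {y} eq with compare x y
  ... | tri< x<y _ _ = ⊥-elim (irrefl eq (exp-mono-< x<y))
  ... | tri≈ _ x≈y _ = x≈y
  ... | tri> _ _ y<x = ⊥-elim (irrefl (sym eq) (exp-mono-< y<x))

  exp-0 : exp 0# ≈ 1#
  exp-0 = begin-equality
    exp 0#                      ≈⟨ solve 1 (λ x → x := (x :- κ 1) :+ κ 1) refl (exp 0#) ⟩
    (exp 0# - 1#) + 1#          ≈⟨ +-congʳ (*-cancelˡ-0 (exp-pos 0#) (begin-equality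
      exp 0# * (exp 0# - 1#)      ≈⟨ solve 1 (λ x → x :* (x :- κ 1) := x :* x :- x) refl (exp 0#) ⟩
      exp 0# * exp 0# - exp 0#    ≈⟨ +-congʳ (exp-+ 0# 0#) ⟨
      exp (0# + 0#) - exp 0#      ≈⟨ +-congʳ (exp-cong (+-identityˡ 0#)) ⟩
      exp 0# - exp 0#             ≈⟨ -‿inverseʳ _ ⟩
      0#                          ∎)) ⟩
    0# + 1#                     ≈⟨ +-identityˡ 1# ⟩
    1#                          ∎

  log-exp : ∀ x → log (exp x) ≈ x
  log-exp x = exp-injective (exp-log (exp-pos x))

  module _ {a} {A : Set a} where

    ∑ₗ-cong : ∀ (xs : List A) {f g : A → Carrier} → (∀ x → f x ≈ g x) → ∑[ xs ] f ≈ ∑[ xs ] g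
    ∑ₗ-cong []       f≈g = refl
    ∑ₗ-cong (x ∷ xs) f≈g = +-cong (f≈g x) (∑ₗ-cong xs f≈g)

    ∑ₗ-zero : ∀ (xs : List A) → ∑[ xs ] (λ _ → 0#) ≈ 0#
    ∑ₗ-zero []       = refl
    ∑ₗ-zero (x ∷ xs) = trans (+-identityˡ _) (∑ₗ-zero xs)

    ∑ₗ-linear : ∀ (xs : List A) s f t g →
                ∑[ xs ] (λ x → s * f x + t * g x) ≈ s * ∑[ xs ] f + t * ∑[ xs ] g
    ∑ₗ-linear []       s f t g = solve 2 (λ s t → κ 0 := s :* κ 0 :+ t :* κ 0) refl s t
    ∑ₗ-linear (x ∷ xs) s f t g = trans (+-congˡ (∑ₗ-linear xs s f t g))
      (solve 6 (λ s t p q u v → (s :* p :+ t :* q) :+ (s :* u :+ t :* v) :=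
                                s :* (p :+ u) :+ t :* (q :+ v)) refl s t _ _ _ _)

    ∑ₗ-exp : ∀ (xs : List A) f → ∏[ xs ] (λ x → exp (f x)) ≈ exp (∑[ xs ] f)
    ∑ₗ-exp []       f = sym exp-0
    ∑ₗ-exp (x ∷ xs) f = trans (*-congˡ (∑ₗ-exp xs f)) (sym (exp-+ _ _))

    exp-∑ₗ-log : ∀ (xs : List A) {f} → (∀ x → 0# < f x) →
                 exp (∑[ xs ] (λ x → log (f x))) ≈ ∏[ xs ] f
    exp-∑ₗ-log []       f>0 = exp-0
    exp-∑ₗ-log (x ∷ xs) f>0 = trans (exp-+ _ _) (*-cong (exp-log (f>0 x)) (exp-∑ₗ-log xs f>0))

  ε-refl : ∀ {n d} (α : Δ n d) → ε α α ≡ 1#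
  ε-refl α with α ≟Δ α
  ... | yes _  = ≡.refl
  ... | no α≢α = ⊥-elim (α≢α ≡.refl)

  ε-≢ : ∀ {n d} {α β : Δ n d} → ¬ (α ≡ β) → ε α β ≡ 0#
  ε-≢ {α = α} {β} α≢β with α ≟Δ β
  ... | yes α≡β = ⊥-elim (α≢β α≡β)
  ... | no _    = ≡.refl

  ∑ₗ-ε : ∀ {n d} {ν : Δ n d} {xs} → Unique xs → ν ∈ₗ xs → (L : Δ n d → Carrier) →
         ∑[ xs ] (λ α → ε ν α * L α) ≈ L ν
  ∑ₗ-ε {ν = ν} {_ ∷ xs} (ν∉xs ∷ _) (here ≡.refl) L = begin-equality
    ε ν ν * L ν + ∑[ xs ] (λ α → ε ν α * L α)
      ≈⟨ +-cong (trans (*-congʳ (reflexive (ε-refl ν))) (*-identityˡ _)) (vanish ν∉xs) ⟩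
    L ν + 0#
      ≈⟨ +-identityʳ _ ⟩
    L ν ∎
    where
    vanish : ∀ {ys} → All (λ α → ¬ (ν ≡ α)) ys → ∑[ ys ] (λ α → ε ν α * L α) ≈ 0#
    vanish []           = refl
    vanish (ν≢α ∷ rest) = trans
      (+-cong (trans (*-congʳ (reflexive (ε-≢ ν≢α))) (zeroˡ _)) (vanish rest)) (+-identityˡ 0#)
  ∑ₗ-ε {ν = ν} {x ∷ xs} (x∉xs ∷ unique) (there ν∈xs) L = begin-equality
    ε ν x * L x + ∑[ xs ] (λ α → ε ν α * L α)
      ≈⟨ +-cong (trans (*-congʳ (reflexive (ε-≢ λ ν≡x →
           All.lookup x∉xs ν∈xs (≡.sym ν≡x)))) (zeroˡ _)) (∑ₗ-ε unique ν∈xs L) ⟩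
    0# + L ν
      ≈⟨ +-identityˡ _ ⟩
    L ν ∎

  infix 8 ⟪_,_⟫
  ⟪_,_⟫ : ∀ {n d} {S : Subset n d} → ℝ^ S → (Δ n d → Carrier) → Carrier
  ⟪_,_⟫ {S = S} w L = ∑[ elements S ] λ α → w α * L (value α)

  -- Makes the ratio the exponential of an expression linear in `w`, so that bounded ratios become
  -- upper bounds on a pairing.
  R≈exp : ∀ {n d} {S : Subset n d} (w : ℝ^ S) f → R w f ≈ exp ⟪ w , (λ α → log (f α)) ⟫
  R≈exp {S = S} w f = ∑ₗ-exp (elements S) (λ α → w α * log (f (value α)))

  ⟪⟫-congˡ : ∀ {n d} {S : Subset n d} {v w : ℝ^ S} → (∀ α → v α ≈ w α) → ∀ L →
             ⟪ v , L ⟫ ≈ ⟪ w , L ⟫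
  ⟪⟫-congˡ {S = S} v≈w L = ∑ₗ-cong (elements S) λ α → *-congʳ (v≈w α)

  ⟪⟫-congʳ : ∀ {n d} {S : Subset n d} (w : ℝ^ S) {K L} → (∀ α → K α ≈ L α) →
             ⟪ w , K ⟫ ≈ ⟪ w , L ⟫
  ⟪⟫-congʳ {S = S} w K≈L = ∑ₗ-cong (elements S) λ α → *-congˡ (K≈L (value α))

  ⟪⟫-linearˡ : ∀ {n d} {S : Subset n d} s (v : ℝ^ S) t w L →
               ⟪ (λ α → s * v α + t * w α) , L ⟫ ≈ s * ⟪ v , L ⟫ + t * ⟪ w , L ⟫
  ⟪⟫-linearˡ {S = S} s v t w L = trans
    (∑ₗ-cong (elements S) λ α →
      solve 5 (λ s p t q l → (s :* p :+ t :* q) :* l := s :* (p :* l) :+ t :* (q :* l))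
              refl s (v α) t (w α) (L (value α)))
    (∑ₗ-linear (elements S) s _ t _)

  ⟪⟫-linearʳ : ∀ {n d} {S : Subset n d} (w : ℝ^ S) s K t L →
               ⟪ w , (λ α → s * K α + t * L α) ⟫ ≈ s * ⟪ w , K ⟫ + t * ⟪ w , L ⟫
  ⟪⟫-linearʳ {S = S} w s K t L = trans
    (∑ₗ-cong (elements S) λ α →
      solve 5 (λ s p t q x → x :* (s :* p :+ t :* q) := s :* (x :* p) :+ t :* (x :* q))
              refl s (K (value α)) t (L (value α)) (w α))
    (∑ₗ-linear (elements S) s _ t _)

  ⟪⟫-zeroˡ : ∀ {n d} {S : Subset n d} L → ⟪_,_⟫ {S = S} (λ _ → 0#) L ≈ 0#
  ⟪⟫-zeroˡ {S = S} L = trans (∑ₗ-cong (elements S) λ α → zeroˡ _) (∑ₗ-zero (elements S))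

  ⟪⟫-∑ : ∀ {n d} {S : Subset n d} m (t : Fin m → Carrier) (v : Fin m → ℝ^ S) L →
         ⟪ (λ α → ∑ λ i → t i * v i α) , L ⟫ ≈ ∑ λ i → t i * ⟪ v i , L ⟫
  ⟪⟫-∑ {S = S} zero    t v L = ⟪⟫-zeroˡ {S = S} L
  ⟪⟫-∑ {S = S} (suc m) t v L = begin-equality
    ⟪ (λ α → t zero * v zero α + ∑ (λ i → t (suc i) * v (suc i) α)) , L ⟫
      ≈⟨ ⟪⟫-congˡ {S = S} (λ α → +-congˡ (sym (*-identityˡ _))) L ⟩
    ⟪ (λ α → t zero * v zero α + 1# * ∑ (λ i → t (suc i) * v (suc i) α)) , L ⟫
      ≈⟨ ⟪⟫-linearˡ {S = S} (t zero) (v zero) 1# _ L ⟩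
    t zero * ⟪ v zero , L ⟫ + 1# * ⟪ (λ α → ∑ (λ i → t (suc i) * v (suc i) α)) , L ⟫
      ≈⟨ +-congˡ (trans (*-identityˡ _) (⟪⟫-∑ {S = S} m (t ∘ suc) (v ∘ suc) L)) ⟩
    t zero * ⟪ v zero , L ⟫ + ∑ (λ i → t (suc i) * ⟪ v (suc i) , L ⟫) ∎

  ⟪ε,⟫ : ∀ {n d} (ν : Δ n d) L → ⟪_,_⟫ {S = full} (λ α → ε ν (value α)) L ≈ L ν
  ⟪ε,⟫ {n} {d} ν L = trans
    (reflexive (≡.trans
      (≡.cong (λ xs → ∑[ xs ] (λ α → ε ν (value α) * L (value α))) (elements-full n d))
      (≡.cong (List.foldr _+_ 0#) (≡.sym (Listₚ.map-∘ (allΔ n d))))))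
    (∑ₗ-ε (allΔ-unique n d) (allΔ-complete ν) L)

  ⟪∑ε,⟫ : ∀ {n d a} {A : Set a} (xs : List A) (w : A → Carrier) (ν : A → Δ n d) L →
          ⟪_,_⟫ {S = full} (λ α → ∑[ xs ] (λ x → w x * ε (ν x) (value α))) L ≈
          ∑[ xs ] (λ x → w x * L (ν x))
  ⟪∑ε,⟫ []       w ν L = ⟪⟫-zeroˡ {S = full} L
  ⟪∑ε,⟫ (x ∷ xs) w ν L = begin-equality
    ⟪ (λ α → w x * ε (ν x) (value α) + rest α) , L ⟫
      ≈⟨ ⟪⟫-congˡ {S = full} (λ α → +-congˡ (sym (*-identityˡ (rest α)))) L ⟩
    ⟪ (λ α → w x * ε (ν x) (value α) + 1# * rest α) , L ⟫
      ≈⟨ ⟪⟫-linearˡ {S = full} (w x) _ 1# rest L ⟩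
    w x * ⟪_,_⟫ {S = full} (λ α → ε (ν x) (value α)) L + 1# * ⟪ rest , L ⟫
      ≈⟨ +-cong (*-congˡ (⟪ε,⟫ (ν x) L)) (trans (*-identityˡ _) (⟪∑ε,⟫ xs w ν L)) ⟩
    w x * L (ν x) + ∑[ xs ] (λ x → w x * L (ν x)) ∎
    where
    rest : ℝ^ full
    rest α = ∑[ xs ] (λ x → w x * ε (ν x) (value α))

  -- Extension by zero from a link is adjoint to restricting a functional to that link.
  ⟪extend,⟫ : ∀ {n k} (β : Δ n k) (v : ℝ^ (full {n} {2})) L →
              ⟪_,_⟫ {S = full} (extend {S = full} β v) L ≈
              ⟪_,_⟫ {S = full} v (λ γ → L (γ ⊕ β))
  ⟪extend,⟫ β v L = ⟪∑ε,⟫ (elements full) v (λ γ → value γ ⊕ β) L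

  ⟪w₅,⟫ : ∀ L → ⟪ w₅ , L ⟫ ≈ ∑[ numerator₅ ] L - ∑[ denominator₅ ] L
  ⟪w₅,⟫ L = begin-equality
    ⟪ w₅ , L ⟫
      ≈⟨ ⟪⟫-congˡ {S = full} {v = w₅} (λ α →
           solve 2 (λ p q → p :- q := κ 1 :* p :+ (:- κ 1) :* q) refl
             (∑[ numerator₅ ] (λ ν → ε ν (value α))) (∑[ denominator₅ ] (λ ν → ε ν (value α)))) L ⟩
    ⟪ (λ α → 1# * indicator numerator₅ α + - 1# * indicator denominator₅ α) , L ⟫
      ≈⟨ ⟪⟫-linearˡ {S = full} 1# (indicator numerator₅) (- 1#) (indicator denominator₅) L ⟩
    1# * ⟪ indicator numerator₅ , L ⟫ + - 1# * ⟪ indicator denominator₅ , L ⟫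
      ≈⟨ +-cong (*-congˡ (pair numerator₅)) (*-congˡ (pair denominator₅)) ⟩
    1# * ∑[ numerator₅ ] L + - 1# * ∑[ denominator₅ ] L
      ≈⟨ solve 2 (λ p q → κ 1 :* p :+ (:- κ 1) :* q := p :- q) refl
           (∑[ numerator₅ ] L) (∑[ denominator₅ ] L) ⟩
    ∑[ numerator₅ ] L - ∑[ denominator₅ ] L ∎
    where
    indicator : List (Δ 5 3) → ℝ^ (full {5} {3})
    indicator xs α = ∑[ xs ] (λ ν → ε ν (value α))
    pair : ∀ xs → ⟪ indicator xs , L ⟫ ≈ ∑[ xs ] L
    pair xs = trans
      (⟪⟫-congˡ {S = full} {v = indicator xs} (λ α → ∑ₗ-cong xs (λ ν → sym (*-identityˡ _))) L)
      (trans (⟪∑ε,⟫ xs (λ _ → 1#) (λ ν → ν) L) (∑ₗ-cong xs (λ ν → *-identityˡ _)))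

-- The cone of bounded ratios, which contains the local generators and `w₅`.

module BoundedRatios {c ℓ : Level} (ℝ : RealNumbers c ℓ) where

  open Lorentzian ℝ hiding (zero)
  open OrderedField ℝ
  open QuadraticForms ℝ
  open Cubic ℝ
  open Pairing ℝ

  -- The bound b is required to be positive so that a pairing equal to 2b already contradicts it;
  -- this is how `split-polar` chooses its parameter.
  LogBounded : ∀ {n k} (S : Subset n (2 ℕ.+ k)) → Pred (ℝ^ S) (c ⊔ ℓ)
  LogBounded S w = ∃[ b ] (0# < b × (∀ f → f ∈ 𝓛⁺ S → ⟪ w , (λ α → log (f α)) ⟫ ≤ b))

  -- The bound log M is positive only for 1 < M, and log is unspecified at nonpositive M. For M ≤ 1
  -- every ratio is at most 1 and the bound 1 will do.
  BR⇒LogBounded : ∀ {n k} {S : Subset n (2 ℕ.+ k)} {w} → w ∈ BR S → w ∈ LogBounded S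
  BR⇒LogBounded {S = S} {w} (M , R≤M) with compare 1# M
  ... | tri< 1<M _ _ = log M , 0<logM , λ f f∈𝓛 → exp-cancel-≤ (begin
          exp ⟪ w , (λ α → log (f α)) ⟫ ≈⟨ R≈exp {S = S} w f ⟨
          R w f                         ≤⟨ R≤M f f∈𝓛 ⟩
          M                             ≈⟨ exp-log 0<M ⟨
          exp (log M)                   ∎)
    where
    0<M : 0# < M
    0<M = <-trans 0<1 1<M
    0<logM : 0# < log M
    0<logM = exp-cancel-< (<-respˡ-≈ (sym exp-0) (<-respʳ-≈ (sym (exp-log 0<M)) 1<M))
  ... | tri≈ _ 1≈M _ = 1# , 0<1 , λ f f∈𝓛 → exp-cancel-≤ (begin
          exp ⟪ w , (λ α → log (f α)) ⟫ ≈⟨ R≈exp {S = S} w f ⟨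
          R w f                         ≤⟨ R≤M f f∈𝓛 ⟩
          M                             ≈⟨ 1≈M ⟨
          1#                            ≈⟨ exp-0 ⟨
          exp 0#                        ≤⟨ exp-mono-≤ 0≤1 ⟩
          exp 1#                        ∎)
  ... | tri> _ _ M<1 = 1# , 0<1 , λ f f∈𝓛 → exp-cancel-≤ (begin
          exp ⟪ w , (λ α → log (f α)) ⟫ ≈⟨ R≈exp {S = S} w f ⟨
          R w f                         ≤⟨ R≤M f f∈𝓛 ⟩
          M                             <⟨ M<1 ⟩
          1#                            ≈⟨ exp-0 ⟨
          exp 0#                        ≤⟨ exp-mono-≤ 0≤1 ⟩
          exp 1#                        ∎)

  LogBounded⇒BR : ∀ {n k} {S : Subset n (2 ℕ.+ k)} {w} → w ∈ LogBounded S → w ∈ BR S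
  LogBounded⇒BR {S = S} {w} (b , _ , bound) = exp b , λ f f∈𝓛 → begin
    R w f                         ≈⟨ R≈exp {S = S} w f ⟩
    exp ⟪ w , (λ α → log (f α)) ⟫ ≤⟨ exp-mono-≤ (bound f f∈𝓛) ⟩
    exp b                         ∎

  BR-conical : ∀ {n k} {S : Subset n (2 ℕ.+ k)} {w} m t (v : Fin m → ℝ^ S) →
    (∀ i → 0# ≤ t i) → (∀ i → v i ∈ BR S) → (∀ α → w α ≈ ∑ (λ i → t i * v i α)) → w ∈ BR S
  BR-conical {S = S} {w} m t v t≥0 v∈BR w≈ = LogBounded⇒BR {S = S} {w}
    -- The summand 1 keeps the bound positive when all coefficients vanish or m is 0.
    (1# + ∑ (λ i → t i * b i) , pos-+ 0<1 (∑-nonneg λ i → nonneg-* (t≥0 i) (inj₁ (b>0 i))) ,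
     λ f f∈𝓛 → begin
       ⟪ w , (λ α → log (f α)) ⟫
         ≈⟨ ⟪⟫-congˡ {S = S} w≈ _ ⟩
       ⟪ (λ α → ∑ λ i → t i * v i α) , (λ α → log (f α)) ⟫
         ≈⟨ ⟪⟫-∑ {S = S} m t v _ ⟩
       ∑ (λ i → t i * ⟪ v i , (λ α → log (f α)) ⟫)
         ≤⟨ ∑-mono (λ i → *-monoˡ-≤ (t≥0 i) (bounded i f f∈𝓛)) ⟩
       ∑ (λ i → t i * b i)
         ≤⟨ ≤-by 1# 0≤1 (+-comm _ _) ⟩
       1# + ∑ (λ i → t i * b i) ∎)
    where
    log-bounded : ∀ i → v i ∈ LogBounded S
    log-bounded i = BR⇒LogBounded {S = S} (v∈BR i)
    b : Fin m → Carrier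
    b i = proj₁ (log-bounded i)
    b>0 : ∀ i → 0# < b i
    b>0 i = proj₁ (proj₂ (log-bounded i))
    bounded : ∀ i f → f ∈ 𝓛⁺ S → ⟪ v i , (λ α → log (f α)) ⟫ ≤ b i
    bounded i = proj₂ (proj₂ (log-bounded i))

  AtMostOne-cong : ∀ {n} {G H : Matrix n} → (∀ i j → G i j ≡ H i j) →
                   AtMostOnePositiveEigenvalue G → AtMostOnePositiveEigenvalue H
  AtMostOne-cong G≡H one {u = u} {v} u-eigen v-eigen = one (transport u-eigen) (transport v-eigen)
    where
    transport : ∀ {λ′ u} → IsEigenvector _ λ′ u → IsEigenvector _ λ′ u
    transport {u = u} (u≉0 , Hu) = u≉0 , λ i →
      trans (dot-cong {y = u} (λ j → reflexive (G≡H i j)) (λ _ → refl)) (Hu i)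

  -- Positive coefficients make the support the whole simplex, which is M-convex once inhabited, so
  -- of the Lorentzian conditions only the Hessians are left to check.
  full-support : ∀ {n k} {f : Polynomial n (2 ℕ.+ k)} → Δ n (2 ℕ.+ k) → (∀ α → 0# < f α) →
                 (∀ β → AtMostOnePositiveEigenvalue (hessian f β)) → f ∈ 𝓛⁺ full
  full-support α₀ f>0 one = record
    { nonneg   = λ α → inj₁ (f>0 α)
    ; nonzero  = α₀ , >⇒≉ (f>0 α₀)
    ; M-convex = universal-M-convex α₀ (λ α → >⇒≉ (f>0 α))
    ; hess     = one
    } , λ α → mk⇔ (λ _ → tt) (λ _ → f>0 α)

  derivative : ∀ {n k} → Polynomial n (2 ℕ.+ k) → Δ n k → Polynomial n 2
  derivative f β γ = f (γ ⊕ β)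

  -- The single Hessian of the quadratic ∂^β f is the Hessian of f at β. The argument of type
  -- `Δ n 2` witnesses that the simplex is inhabited.
  derivative-Lorentzian : ∀ {n k} {f : Polynomial n (2 ℕ.+ k)} → f ∈ 𝓛⁺ full →
                          ∀ β → Δ n 2 → derivative f β ∈ 𝓛⁺ {n} {0} full
  derivative-Lorentzian {f = f} f∈𝓛 β γ₀ = full-support γ₀
    (λ γ → coefficient-pos {f = f} f∈𝓛 (γ ⊕ β))
    (λ ζ → AtMostOne-cong
      (λ i j → ≡.cong f (≡.sym (⊕-degree-zero i j ζ β)))
      (IsLorentzian.hess (proj₁ f∈𝓛) β))

  -- The ratio of f with the extended exponent equals the ratio of ∂^β f with v, so a bound for
  -- quadratics carries over unchanged.
  𝓖⊆BR : ∀ {n k} {w} → w ∈ 𝓖 {n} {k} full → w ∈ BR {n} {k} full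
  𝓖⊆BR {w = w} (β , (γ₀ ⊣ _) , v , (M , R≤M) , w≈) = M , λ f f∈𝓛 → begin
    R {S = full} w f
      ≈⟨ R≈exp {S = full} w f ⟩
    exp (⟪_,_⟫ {S = full} w (λ α → log (f α)))
      ≈⟨ exp-cong (trans (⟪⟫-congˡ {S = full} w≈ _) (⟪extend,⟫ β v _)) ⟩
    exp (⟪_,_⟫ {S = full} v (λ γ → log (derivative f β γ)))
      ≈⟨ R≈exp {S = full} v (derivative f β) ⟨
    R {S = full} v (derivative f β)
      ≤⟨ R≤M (derivative f β) (derivative-Lorentzian {f = f} f∈𝓛 β γ₀) ⟩
    M ∎

  Cone𝓖⊆BR : ∀ {n k} → Cone (𝓖 {n} {k} full) ⊆ BR {n} {k} full
  Cone𝓖⊆BR {x = w} (m , t , v , t≥0 , v∈𝓖 , w≈) =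
    BR-conical {S = full} {w} m t v t≥0 (λ i → 𝓖⊆BR {w = v i} (v∈𝓖 i)) w≈

  -- `R` is a product of real powers over the whole simplex and `R₅` a literal quotient of ten
  -- coefficients; passing to logarithms identifies them, and the bound 32 applies.
  w₅∈BR : w₅ ∈ BR {5} {1} full
  w₅∈BR = fromℕ 32 , λ f f∈𝓛 →
    let L = λ α → log (f α)
        f>0 = coefficient-pos {f = f} f∈𝓛
    in begin
    R {S = full} w₅ f
      ≈⟨ R≈exp {S = full} w₅ f ⟩
    exp (⟪_,_⟫ {S = full} w₅ L)
      ≈⟨ exp-cong (⟪w₅,⟫ L) ⟩
    exp (∑[ numerator₅ ] L - ∑[ denominator₅ ] L)
      ≈⟨ exp-+ _ _ ⟩
    exp (∑[ numerator₅ ] L) * exp (- ∑[ denominator₅ ] L)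
      ≈⟨ *-cong (exp-∑ₗ-log numerator₅ f>0) (exp-neg
           (exp-∑ₗ-log denominator₅ f>0)) ⟩
    R₅ f
      ≤⟨ R₅≤32 f∈𝓛 ⟩
    fromℕ 32 ∎
    where
    exp-neg : ∀ {x y} → exp x ≈ y → exp (- x) ≈ y ⁻¹
    exp-neg {x} {y} eq = begin-equality
      exp (- x)                    ≈⟨ *-identityʳ _ ⟨
      exp (- x) * 1#               ≈⟨ *-congˡ (*-inverseʳ y (λ y≈0 → >⇒≉ (exp-pos x) (trans eq y≈0))) ⟨
      exp (- x) * (y * y ⁻¹)       ≈⟨ *-assoc _ _ _ ⟨
      exp (- x) * y * y ⁻¹         ≈⟨ *-congʳ (*-congˡ eq) ⟨
      exp (- x) * exp x * y ⁻¹     ≈⟨ *-congʳ (exp-+ _ _) ⟨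
      exp (- x + x) * y ⁻¹         ≈⟨ *-congʳ (trans (exp-cong (-‿inverseˡ x)) exp-0) ⟩
      1# * y ⁻¹                    ≈⟨ *-identityˡ _ ⟩
      y ⁻¹                         ∎

-- Split metrics and the functionals they bound on the local generators.

⊕-identityʳ : ∀ {n} i j (ζ : Δ n 0) → e i ⊕ e j ⊕ ζ ≡ e i ⊕ e j
⊕-identityʳ i j (z ⊣ [ p ]) = Δ-≡ (≡.cong (zipWith ℕ._+_ (unit i)) (≡.trans
  (≡.cong (zipWith ℕ._+_ (unit j)) (sum≡0 z (recompute (_ ℕₚ.≟ _) p)))
  (Vecₚ.zipWith-identityʳ ℕₚ.+-identityʳ (unit j))))

-- Up to a linear function and a decrease of the values at 2eᵢ, the function m
-- is s times the split metric of the bipartition given by side.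
record IsSplit {n} (a : Vec ℕ n) (side : Vec Bool n) (s : ℕ) (m : Δ n 2 → ℕ) : Set where
  constructor split
  field
    off-diagonal : ∀ i j → i ≡ j ⊎ m (e i ⊕ e j) ≡ lookup a i ℕ.+ lookup a j ℕ.+
                             (if lookup side i xor lookup side j then s else 0)
    diagonal     : ∀ i → m (e i ⊕ e i) ℕ.≤ lookup a i ℕ.+ lookup a i

isSplit? : ∀ {n} a side s (m : Δ n 2 → ℕ) → Dec (IsSplit a side s m)
isSplit? a side s m = map′ (λ (p , q) → split p q) (λ (split p q) → p , q)
  (Finₚ.all? (λ i → Finₚ.all? λ j → (i Finₚ.≟ j) ⊎-dec (_ ℕₚ.≟ _)) ×-dec
   Finₚ.all? (λ i → _ ℕₚ.≤? _))

module Splits {c ℓ : Level} (ℝ : RealNumbers c ℓ) where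

  open Lorentzian ℝ hiding (zero)
  open OrderedField ℝ
  open QuadraticForms ℝ
  open Entries ℝ
  open Cubic ℝ
  open Pairing ℝ
  open BoundedRatios ℝ

  δ-≢ : ∀ {n} {i j : Fin n} → ¬ (i ≡ j) → δ i j ≈ 0#
  δ-≢ {i = zero}  {zero}  i≢j = ⊥-elim (i≢j ≡.refl)
  δ-≢ {i = zero}  {suc j} i≢j = refl
  δ-≢ {i = suc i} {zero}  i≢j = refl
  δ-≢ {i = suc i} {suc j} i≢j = δ-≢ {i = i} {j} (i≢j ∘ ≡.cong suc)

  -- On the hyperplane (P + Q) · x = 0 the form is
  -- −2 (T − 1) (P · x)² − Σ Dᵢ xᵢ².
  two-block-AtMostOne : ∀ {n} {H : Matrix n} → Symmetric H → ∀ (P Q D : Fin n → Carrier) T →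
    1# ≤ T → (∀ i → 0# ≤ D i) →
    (∀ i j → H i j ≈ combine 1# (combine (P i + T * Q i) P (Q i + T * P i) Q) (- D i) (δ i) j) →
    AtMostOnePositiveEigenvalue H
  two-block-AtMostOne {n} {H} H-sym P Q D T 1≤T D≥0 H≈ =
    nonpositive-on-hyperplane {H = H} H-sym (combine 1# P 1# Q) nonpositive
    where
    module _ (x : Fin n → Carrier) where
      p q S : Carrier
      p = dot P x
      q = dot Q x
      S = ∑ λ i → x i * (D i * x i)
      mul-H : ∀ i → mul H x i ≈
              combine 1# (combine (p + T * q) P (q + T * p) Q) (- 1#) (λ i → D i * x i) i
      mul-H i = begin-equality
        dot (H i) x
          ≈⟨ dot-cong {y = x} (H≈ i) (λ _ → refl) ⟩
        dot (combine 1# (combine (P i + T * Q i) P (Q i + T * P i) Q) (- D i) (δ i)) x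
          ≈⟨ dot-linearˡ x 1# (combine (P i + T * Q i) P (Q i + T * P i) Q) (- D i) (δ i) ⟩
        1# * dot (combine (P i + T * Q i) P (Q i + T * P i) Q) x + - D i * dot (δ i) x
          ≈⟨ +-cong (*-congˡ (dot-linearˡ x _ P _ Q)) (*-congˡ (dot-δˡ i x)) ⟩
        1# * ((P i + T * Q i) * p + (Q i + T * P i) * q) + - D i * x i
          ≈⟨ +-cong (*-congˡ (solve 5 (λ u v t p q →
                 (u :+ t :* v) :* p :+ (v :+ t :* u) :* q :=
                 (p :+ t :* q) :* u :+ (q :+ t :* p) :* v) refl (P i) (Q i) T p q))
               (solve 2 (λ d x → (:- d) :* x := (:- κ 1) :* (d :* x)) refl (D i) (x i)) ⟩
        1# * ((p + T * q) * P i + (q + T * p) * Q i) + - 1# * (D i * x i) ∎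
      form-H : form H x x ≈ 1# * ((p + T * q) * p + (q + T * p) * q) + - 1# * S
      form-H = begin-equality
        form H x x
          ≈⟨ dot-cong {x = x} (λ _ → refl) mul-H ⟩
        dot x (combine 1# (combine (p + T * q) P (q + T * p) Q) (- 1#) (λ i → D i * x i))
          ≈⟨ dot-linearʳ x 1# _ (- 1#) _ ⟩
        1# * dot x (combine (p + T * q) P (q + T * p) Q) + - 1# * S
          ≈⟨ +-congʳ (*-congˡ (dot-linearʳ x _ P _ Q)) ⟩
        1# * ((p + T * q) * dot x P + (q + T * p) * dot x Q) + - 1# * S
          ≈⟨ +-congʳ (*-congˡ (+-cong (*-congˡ (dot-comm x P)) (*-congˡ (dot-comm x Q)))) ⟩
        1# * ((p + T * q) * p + (q + T * p) * q) + - 1# * S ∎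
      0≤S : 0# ≤ S
      0≤S = ∑-nonneg λ i → ≤-trans (nonneg-* (D≥0 i) (square-nonneg (x i)))
        (inj₂ (solve 2 (λ d x → d :* (x :* x) := x :* (d :* x)) refl (D i) (x i)))
      nonpositive : dot (combine 1# P 1# Q) x ≈ 0# → form H x x ≤ 0#
      nonpositive h≈0 = ≤-by (2# * (T - 1#) * (p * p) + S)
        (nonneg-+ (nonneg-* (nonneg-* (inj₁ 0<2) (x≤y⇒0≤y-x 1≤T)) (square-nonneg p)) 0≤S)
        (begin-equality
        0#
          ≈⟨ trans (*-congʳ (trans (sym (dot-linearˡ x 1# P 1# Q)) h≈0)) (zeroˡ _) ⟨
        (1# * p + 1# * q) * (2# * (T - 1#) * p + (p + q))
          ≈⟨ solve 4 (λ p q t s →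
               (κ 1 :* p :+ κ 1 :* q) :* (κ 2 :* (t :- κ 1) :* p :+ (p :+ q)) :=
               (κ 1 :* ((p :+ t :* q) :* p :+ (q :+ t :* p) :* q) :+ (:- κ 1) :* s) :+
               (κ 2 :* (t :- κ 1) :* (p :* p) :+ s)) refl p q T S ⟩
        (1# * ((p + T * q) * p + (q + T * p) * q) + - 1# * S) + (2# * (T - 1#) * (p * p) + S)
          ≈⟨ +-congʳ form-H ⟨
        form H x x + (2# * (T - 1#) * (p * p) + S) ∎)

  -- Exponentiating the additive formula gives a two-block matrix. With Aᵢ = exp (t aᵢ), the vectors
  -- P and Q are A restricted to the two sides, entries across the sides gain the factor T = exp (t
  -- s), and D records the decrease on the diagonal. From t ≥ 0 follow T ≥ 1 and D ≥ 0, the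
  -- hypotheses of `two-block-AtMostOne`.
  module SplitFamily {n} {a : Vec ℕ n} {side : Vec Bool n} {s : ℕ} {m : Δ n 2 → ℕ}
                     (m-split : IsSplit a side s m) {t : Carrier} (0≤t : 0# ≤ t) where

    power : ℕ → Carrier
    power k = exp (t * fromℕ k)

    family : Polynomial n 2
    family γ = power (m γ)

    power-+ : ∀ k l → power (k ℕ.+ l) ≈ power k * power l
    power-+ k l = trans
      (exp-cong (trans (*-congˡ (×-homo-+ 1# k l)) (distribˡ t _ _))) (exp-+ _ _)

    fromℕ-nonneg : ∀ k → 0# ≤ fromℕ k
    fromℕ-nonneg zero    = inj₂ refl
    fromℕ-nonneg (suc k) = nonneg-+ 0≤1 (fromℕ-nonneg k)

    power-mono : ∀ {k l} → k ℕ.≤ l → power k ≤ power l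
    power-mono {k} {l} k≤l = exp-mono-≤ (*-monoˡ-≤ 0≤t
      (≤-by (fromℕ (l ℕ.∸ k)) (fromℕ-nonneg (l ℕ.∸ k))
        (trans (×-congˡ (≡.sym (ℕₚ.m+[n∸m]≡n k≤l))) (×-homo-+ 1# k (l ℕ.∸ k)))))

    power-0 : power 0 ≈ 1#
    power-0 = trans (exp-cong (zeroʳ t)) exp-0

    G : Matrix n
    G i j = family (e i ⊕ e j)

    A P Q D : Fin n → Carrier
    A i = power (lookup a i)
    P i = if lookup side i then A i else 0#
    Q i = if lookup side i then 0# else A i
    D i = A i * A i - G i i

    D≥0 : ∀ i → 0# ≤ D i
    D≥0 i = x≤y⇒0≤y-x (≤-trans (power-mono {l = lookup a i ℕ.+ lookup a i} (IsSplit.diagonal m-split i)) (inj₂ (power-+ (lookup a i) (lookup a i))))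

    off-diagonal : ∀ i j →
      A i * A j * power (if lookup side i xor lookup side j then s else 0) ≈
      (P i + power s * Q i) * P j + (Q i + power s * P i) * Q j
    off-diagonal i j with lookup side i | lookup side j
    ... | true  | true  = trans (*-congˡ power-0) (solve 3 (λ u v t →
            u :* v :* κ 1 := (u :+ t :* κ 0) :* v :+ (κ 0 :+ t :* u) :* κ 0) refl (A i) (A j) (power s))
    ... | true  | false = solve 3 (λ u v t →
            u :* v :* t := (u :+ t :* κ 0) :* κ 0 :+ (κ 0 :+ t :* u) :* v) refl (A i) (A j) (power s)
    ... | false | true  = solve 3 (λ u v t →
            u :* v :* t := (κ 0 :+ t :* u) :* v :+ (u :+ t :* κ 0) :* κ 0) refl (A i) (A j) (power s)
    ... | false | false = trans (*-congˡ power-0) (solve 3 (λ u v t →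
            u :* v :* κ 1 := (κ 0 :+ t :* u) :* κ 0 :+ (u :+ t :* κ 0) :* v) refl (A i) (A j) (power s))

    diagonal : ∀ i → A i * A i ≈ (P i + power s * Q i) * P i + (Q i + power s * P i) * Q i
    diagonal i with lookup side i
    ... | true  = solve 2 (λ u t →
            u :* u := (u :+ t :* κ 0) :* u :+ (κ 0 :+ t :* u) :* κ 0) refl (A i) (power s)
    ... | false = solve 2 (λ u t →
            u :* u := (κ 0 :+ t :* u) :* κ 0 :+ (u :+ t :* κ 0) :* u) refl (A i) (power s)

    G≈ : ∀ i j → G i j ≈
         combine 1# (combine (P i + power s * Q i) P (Q i + power s * P i) Q) (- D i) (δ i) j
    G≈ i j with i Finₚ.≟ j
    ... | yes ≡.refl = begin-equality
      G i i
        ≈⟨ solve 2 (λ u g → g := κ 1 :* u :+ (:- (u :- g)) :* κ 1) refl (A i * A i) (G i i) ⟩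
      1# * (A i * A i) + - D i * 1#
        ≈⟨ +-cong (*-congˡ (diagonal i)) (*-congˡ (sym (δ-refl i))) ⟩
      1# * ((P i + power s * Q i) * P i + (Q i + power s * P i) * Q i) + - D i * δ i i ∎
    ... | no i≢j = begin-equality
      G i j
        ≈⟨ reflexive (≡.cong power ([ (λ i≡j → ⊥-elim (i≢j i≡j)) , (λ eq → eq) ]′ (IsSplit.off-diagonal m-split i j))) ⟩
      power (lookup a i ℕ.+ lookup a j ℕ.+ cross)
        ≈⟨ trans (power-+ (lookup a i ℕ.+ lookup a j) cross)
                 (*-congʳ (power-+ (lookup a i) (lookup a j))) ⟩
      A i * A j * power cross
        ≈⟨ off-diagonal i j ⟩
      block
        ≈⟨ solve 2 (λ u d → u := κ 1 :* u :+ d :* κ 0) refl block (- D i) ⟩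
      1# * block + - D i * 0#
        ≈⟨ +-congˡ (*-congˡ (δ-≢ i≢j)) ⟨
      1# * block + - D i * δ i j ∎
      where
      cross = if lookup side i xor lookup side j then s else 0
      block = (P i + power s * Q i) * P j + (Q i + power s * P i) * Q j

    family-Lorentzian : Δ n 2 → family ∈ 𝓛⁺ {n} {0} full
    family-Lorentzian γ₀ = full-support γ₀ (λ γ → exp-pos _) (λ ζ →
      AtMostOne-cong {G = G} (λ i j → ≡.cong family (≡.sym (⊕-identityʳ i j ζ)))
        (two-block-AtMostOne {H = G}
          (λ i j → reflexive (≡.cong family (Δ-≡ (Vecₚ.zipWith-comm ℕₚ.+-comm (unit i) (unit j)))))
          P Q D (power s) (≤-trans (inj₂ (sym power-0)) (power-mono {l = s} ℕ.z≤n)) D≥0 G≈))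

  -- Membership of m in the polar cone of the bounded ratios of quadratics. Being a linear condition
  -- it is stable under sums, whereas exp (t m) being Lorentzian for all t ≥ 0 is not.
  record PolarToBR {n} (m : Δ n 2 → ℕ) : Set (c ⊔ ℓ) where
    constructor polar
    field
      pairing≤0 : ∀ (v : ℝ^ (full {n} {2})) → v ∈ BR {n} {0} full →
                  ⟪_,_⟫ {S = full} v (λ γ → fromℕ (m γ)) ≤ 0#

  open PolarToBR

  -- The logarithms of the family t ↦ exp (t m) are t m, so its ratio is
  -- unbounded as soon as the pairing with m is positive.
  split-polar : ∀ {n} {a : Vec ℕ n} {side s} {m : Δ n 2 → ℕ} → Δ n 2 → IsSplit a side s m → PolarToBR m
  split-polar {n} {m = m} γ₀ m-split = polar λ v v∈BR →
    ≮⇒≥ λ 0<p → unbounded v 0<p (BR⇒LogBounded {S = full} v∈BR)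
    where
    module _ (v : ℝ^ (full {n} {2})) where
      p = ⟪_,_⟫ {S = full} v (λ γ → fromℕ (m γ))
      unbounded : 0# < p → v ∈ LogBounded {n} {0} full → ⊥
      unbounded 0<p (b , 0<b , bound) = ≤-<-absurd (begin
        b + b
          ≈⟨ trans (*-congˡ (*-inverseʳ p (>⇒≉ 0<p))) (*-identityʳ _) ⟨
        (b + b) * (p * p ⁻¹)
          ≈⟨ solve 3 (λ b p i → b :* (p :* i) := b :* i :* p) refl (b + b) p (p ⁻¹) ⟩
        t * p
          ≈⟨ solve 2 (λ t p → t :* p := t :* p :+ κ 0 :* p) refl t p ⟩
        t * p + 0# * p
          ≈⟨ ⟪⟫-linearʳ {S = full} v t (λ γ → fromℕ (m γ)) 0# (λ γ → fromℕ (m γ)) ⟨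
        ⟪_,_⟫ {S = full} v (λ γ → t * fromℕ (m γ) + 0# * fromℕ (m γ))
          ≈⟨ ⟪⟫-congʳ {S = full} v (λ γ → trans
               (solve 2 (λ t p → t :* p :+ κ 0 :* p := t :* p) refl t (fromℕ (m γ)))
               (sym (log-exp _))) ⟩
        ⟪_,_⟫ {S = full} v (λ γ → log (family γ))
          ≤⟨ bound family (family-Lorentzian γ₀) ⟩
        b ∎) (<-by b 0<b refl)
        where
        t = (b + b) * p ⁻¹
        0≤t : 0# ≤ t
        0≤t = inj₁ (*-pos (pos-+ 0<b (inj₁ 0<b)) (⁻¹-pos 0<p))
        open SplitFamily m-split 0≤t

  polar-+ : ∀ {n} {k l : Δ n 2 → ℕ} → PolarToBR k → PolarToBR l → PolarToBR (λ γ → k γ ℕ.+ l γ)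
  polar-+ {k = k} {l} k-polar l-polar = polar λ v v∈BR → begin
    ⟪_,_⟫ {S = full} v (λ γ → fromℕ (k γ ℕ.+ l γ))
      ≈⟨ ⟪⟫-congʳ {S = full} v (λ γ → trans (×-homo-+ 1# (k γ) (l γ))
           (+-cong (sym (*-identityˡ _)) (sym (*-identityˡ _)))) ⟩
    ⟪_,_⟫ {S = full} v (λ γ → 1# * fromℕ (k γ) + 1# * fromℕ (l γ))
      ≈⟨ ⟪⟫-linearʳ {S = full} v 1# (λ γ → fromℕ (k γ)) 1# (λ γ → fromℕ (l γ)) ⟩
    1# * ⟪_,_⟫ {S = full} v (λ γ → fromℕ (k γ)) + 1# * ⟪_,_⟫ {S = full} v (λ γ → fromℕ (l γ))
      ≈⟨ +-cong (*-identityˡ _) (*-identityˡ _) ⟩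
    ⟪_,_⟫ {S = full} v (λ γ → fromℕ (k γ)) + ⟪_,_⟫ {S = full} v (λ γ → fromℕ (l γ))
      ≤⟨ +-mono-≤ (pairing≤0 k-polar v v∈BR) (pairing≤0 l-polar v v∈BR) ⟩
    0# + 0#
      ≈⟨ +-identityˡ 0# ⟩
    0# ∎

  polar-cong : ∀ {n} {k l : Δ n 2 → ℕ} → (∀ γ → k γ ≡ l γ) → PolarToBR k → PolarToBR l
  polar-cong k≡l k-polar = polar λ v v∈BR → ≤-trans
    (inj₂ (⟪⟫-congʳ {S = full} v (λ γ → reflexive (≡.cong fromℕ (≡.sym (k≡l γ))))))
    (pairing≤0 k-polar v v∈BR)

  -- A local generator at β pairs with h exactly as its quadratic exponent pairs with the link of h
  -- at β, so polarity of all links passes to the whole cone.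
  Cone-polar : ∀ {n k} (h : Δ n (2 ℕ.+ k) → ℕ) → (∀ β → PolarToBR (λ γ → h (γ ⊕ β))) →
               ∀ {w} → w ∈ Cone (𝓖 {n} {k} full) → ⟪_,_⟫ {S = full} w (λ α → fromℕ (h α)) ≤ 0#
  Cone-polar h h-polar {w} (m , t , v , t≥0 , v∈𝓖 , w≈) = begin
    ⟪_,_⟫ {S = full} w (λ α → fromℕ (h α))
      ≈⟨ ⟪⟫-congˡ {S = full} w≈ _ ⟩
    ⟪_,_⟫ {S = full} (λ α → ∑ λ i → t i * v i α) (λ α → fromℕ (h α))
      ≈⟨ ⟪⟫-∑ {S = full} m t v _ ⟩
    ∑ (λ i → t i * ⟪_,_⟫ {S = full} (v i) (λ α → fromℕ (h α)))
      ≤⟨ ∑-nonpos (λ i → ≤-trans (*-monoˡ-≤ (t≥0 i) (generator (v i) (v∈𝓖 i))) (inj₂ (zeroʳ (t i)))) ⟩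
    0# ∎
    where
    ∑-nonpos : ∀ {m} {f : Fin m → Carrier} → (∀ i → f i ≤ 0#) → ∑ f ≤ 0#
    ∑-nonpos {zero}  f≤0 = inj₂ refl
    ∑-nonpos {suc m} f≤0 = ≤-trans (+-mono-≤ (f≤0 zero) (∑-nonpos (f≤0 ∘ suc))) (inj₂ (+-identityˡ 0#))
    generator : ∀ w → w ∈ 𝓖 full → ⟪_,_⟫ {S = full} w (λ α → fromℕ (h α)) ≤ 0#
    generator w (β , _ , u , u∈BR , w≈) = ≤-trans
      (inj₂ (trans (⟪⟫-congˡ {S = full} w≈ _) (⟪extend,⟫ β u _))) (pairing≤0 (h-polar β) u u∈BR)

-- The functional that separates `w₅` from the local cone.

-- The separating functional, found by linear programming.  Its links are sums
-- of split functions although it is not itself M-concave.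
height : Vec ℕ 5 → ℕ
height (3 ∷ _)                   = 0
height (_ ∷ _ ∷ 0 ∷ 0 ∷ 0 ∷ []) = 6
height (_ ∷ 0 ∷ _ ∷ 0 ∷ 0 ∷ []) = 4
height (_ ∷ 0 ∷ 0 ∷ _ ∷ 0 ∷ []) = 4
height (_ ∷ 0 ∷ 0 ∷ 0 ∷ _ ∷ []) = 4
height _                         = 8

inside : Vec Bool 5 → Vec ℕ 5 → ℕ
inside side γ = Vec.sum (zipWith (λ b k → if b then k else 0) side γ)

-- On eᵢ + eⱼ the product is 1 if the bipartition separates i from j and 0 otherwise, in particular
-- 0 at 2eᵢ: this is the split metric.
cut : Vec Bool 5 → Δ 5 2 → ℕ
cut side γ = inside side (value γ) ℕ.* inside (Vec.map not side) (value γ)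

-- What the link of `height` at a leaves after its three cuts are removed: the linear function with
-- weights (0,3,3,3,3), lowered from 6 to 4 at 2c, 2d and 2e.
base : Vec ℕ 5 → ℕ
base (_ ∷ _ ∷ 2 ∷ _)         = 4
base (_ ∷ _ ∷ _ ∷ 2 ∷ _)     = 4
base (_ ∷ _ ∷ _ ∷ _ ∷ 2 ∷ _) = 4
base (k ∷ _)                 = 3 ℕ.* (2 ℕ.∸ k)

module Separation {c ℓ : Level} (ℝ : RealNumbers c ℓ) where

  open Lorentzian ℝ hiding (zero)
  open OrderedField ℝ
  open Pairing ℝ
  open BoundedRatios ℝ
  open Splits ℝ

  private
    γ₀ : Δ 5 2
    γ₀ = ⟦ 2 ∷ 0 ∷ 0 ∷ 0 ∷ 0 ∷ [] ⟧

    none : Vec Bool 5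
    none = replicate 5 false

    only : Fin 5 → Vec Bool 5 → Vec Bool 5
    only i side = updateAt side i (λ _ → true)

  cut-polar : ∀ i → PolarToBR (cut (only ib (only i none)))
  cut-polar i = split-polar γ₀ (cut-split i)
    where
    cut-split : ∀ i → IsSplit (replicate 5 0) (only ib (only i none)) 1 (cut (only ib (only i none)))
    cut-split = toWitness {a? = Finₚ.all? λ i → isSplit? (replicate 5 0) _ 1 (cut (only ib (only i none)))} tt

  -- The links at b, c, d and e are single splits, cutting off {a,b} with weight 1 and {a,c}, {a,d},
  -- {a,e} with weight 2. The link at a is no single split and needs the cuts {b,c}, {b,d}, {b,e} on
  -- top of `base`. Every claim is a finite check, settled by evaluation.
  height-link : ∀ β → PolarToBR (λ γ → height (value (γ ⊕ β)))
  height-link β = All.lookup links (allΔ-complete β)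
    where
    pieces : Δ 5 2 → ℕ
    pieces γ = cut (only ib (only ic none)) γ ℕ.+ (cut (only ib (only id none)) γ ℕ.+
               (cut (only ib (only ie none)) γ ℕ.+ base (value γ)))
    link-a : ∀ γ → pieces γ ≡ height (value (γ ⊕ e ia))
    link-a γ = All.lookup
      (toWitness {a? = All.all? (λ γ → pieces γ ℕₚ.≟ height (value (γ ⊕ e ia))) (allΔ 5 2)} tt)
      (allΔ-complete γ)
    links : All (λ β → PolarToBR (λ γ → height (value (γ ⊕ β)))) (allΔ 5 1)
    links =
      polar-cong link-a (polar-+ (cut-polar ic) (polar-+ (cut-polar id) (polar-+ (cut-polar ie)
        (split-polar γ₀ (toWitness {a? = isSplit? (0 ∷ 3 ∷ 3 ∷ 3 ∷ 3 ∷ []) none 0 (base ∘ value)} tt))))) ∷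
      split-polar γ₀ (toWitness {a? = isSplit? (3 ∷ 3 ∷ 4 ∷ 4 ∷ 4 ∷ []) (only ia (only ib none)) 1
        (λ γ → height (value (γ ⊕ e ib)))} tt) ∷
      split-polar γ₀ (toWitness {a? = isSplit? (2 ∷ 4 ∷ 2 ∷ 4 ∷ 4 ∷ []) (only ia (only ic none)) 2
        (λ γ → height (value (γ ⊕ e ic)))} tt) ∷
      split-polar γ₀ (toWitness {a? = isSplit? (2 ∷ 4 ∷ 4 ∷ 2 ∷ 4 ∷ []) (only ia (only id none)) 2
        (λ γ → height (value (γ ⊕ e id)))} tt) ∷
      split-polar γ₀ (toWitness {a? = isSplit? (2 ∷ 4 ∷ 4 ∷ 4 ∷ 2 ∷ []) (only ia (only ie none)) 2
        (λ γ → height (value (γ ⊕ e ie)))} tt) ∷ []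

  ∑ₗ-fromℕ : ∀ {a} {A : Set a} (xs : List A) h →
             ∑[ xs ] (λ x → fromℕ (h x)) ≈ fromℕ (ListAction.sum (List.map h xs))
  ∑ₗ-fromℕ []       h = refl
  ∑ₗ-fromℕ (x ∷ xs) h = trans (+-congˡ (∑ₗ-fromℕ xs h)) (sym (×-homo-+ 1# (h x) _))

  -- The heights sum to 30 over the numerator and to 28 over the denominator. The surplus 2 is the
  -- failure of the three-term inequality in the link of a: aab and acd have total height 14,
  -- whereas aad with abc and aac with abd have only 12. The companion inequalities of either
  -- alternative hold with equality of heights.
  w₅∉Cone : w₅ ∉ Cone (𝓖 {5} {1} full)
  w₅∉Cone w₅∈Cone = ≤-<-absurd
    (Cone-polar (height ∘ value) height-link {w = w₅} w₅∈Cone)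
    (<-respʳ-≈ (sym (begin-equality
      ⟪_,_⟫ {S = full} w₅ (λ α → fromℕ (height (value α)))
        ≈⟨ ⟪w₅,⟫ (λ α → fromℕ (height (value α))) ⟩
      ∑[ numerator₅ ] (λ α → fromℕ (height (value α))) - ∑[ denominator₅ ] (λ α → fromℕ (height (value α)))
        ≈⟨ +-cong (∑ₗ-fromℕ numerator₅ (height ∘ value)) (-‿cong (∑ₗ-fromℕ denominator₅ (height ∘ value))) ⟩
      fromℕ (2 ℕ.+ 28) - fromℕ 28
        ≈⟨ +-congʳ (×-homo-+ 1# 2 28) ⟩
      (fromℕ 2 + fromℕ 28) - fromℕ 28
        ≈⟨ solve 2 (λ x y → (x :+ y) :- y := x) refl (fromℕ 2) (fromℕ 28) ⟩
      fromℕ 2 ∎)) (pos-+ 0<1 (nonneg-+ 0≤1 (inj₂ refl))))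

theorem4p3 : ∀ {c ℓ : Level} (ℝ : RealNumbers c ℓ) →
    let open Lorentzian ℝ in
    (∀ f → f ∈ 𝓛⁺ {5} {1} full → R₅ f ≤ fromℕ 32)
    × w₅ ∈ BR {5} {1} full ∖ Cone (𝓖 {5} {1} full)
    × Cone (𝓖 {5} {1} full) ⊂ BR {5} {1} full
theorem4p3 ℝ =
  (λ f f∈𝓛 → Cubic.R₅≤32 ℝ f∈𝓛) ,
  (w₅∈BR , w₅∉Cone) ,
  (λ {w} → Cone𝓖⊆BR {x = w}) , λ BR⊆Cone → w₅∉Cone (BR⊆Cone w₅∈BR)
  where
  open BoundedRatios ℝ
  open Separation ℝ
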